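{- Let $L'$ be the Laplacian matrix of the Grassmann graph $\Gamma'$ on the $2$-dimensional subspaces of $V=\mathbb F_q^n$, where $n\ge4$ and $q=p^t$. Then $L'$ has no nontrivial $p$-elementary divisors; that is, $p$ does not divide the order of the critical group $K(\Gamma')$.
   Context: Let $p$ be a prime, $q=p^t$ with $t\ge1$, $n\ge4$, and $V$ an $n$-dimensional vector space over $\mathbb F_q$. The Grassmann graph $\Gamma'$ has as vertices the $2$-dimensional subspaces of $V$, two distinct ones being adjacent when their intersection is nonzero. If $A'$ is its adjacency matrix and $k'$ its valency, $L'=k'I-A'$. The critical group $K(\Gamma')$ is the torsion subgroup of the cokernel of $L'$ viewed as an endomorphism of the free abelian group on the vertices. -}

module Defs where

open import Algebra.Apartness.Bundles using (HeytingField; HeytingCommutativeRing)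
open import Algebra.Bundles using (AbelianGroup; CommutativeRing)
import Algebra.Construct.Pointwise as Pointwise
open import Algebra.Module.Bundles using (Module)
open import Algebra.Morphism.Structures using (IsGroupHomomorphism)
import Algebra.Properties.AbelianGroup as AbelianGroupProperties
import Algebra.Properties.CommutativeMonoid.Mult as Mult
import Algebra.Properties.CommutativeMonoid.Sum as Sum
import Algebra.Properties.Semiring.Sum as SemiringSum
open import Data.Bool.Base using (if_then_else_)
open import Data.Fin.Base using (Fin; zero; suc; finToFun; funToFin; toℕ)
open import Data.Fin.Properties using (_≟_; any?; all?; finToFun-funToFin)
open import Data.Integer.Base as ℤ using (ℤ; 0ℤ; 1ℤ; +_)
import Data.Integer.Properties as ℤ
open import Data.List.Base using (length; filter; allFin)
open import Data.Maybe.Base using (Maybe; just; nothing)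
open import Data.Nat.Base as ℕ using (ℕ; NonZero)
open import Data.Nat.Divisibility using (_∣_)
import Data.Nat.Properties as ℕ
open import Data.Product.Base using (Σ; ∃; ∃₂; _×_; _,_; proj₁; proj₂)
open import Data.Vec.Functional using (Vector; _∷_)
open import Function.Base using (_∘_; _on_)
open import Function.Bundles using (Inverse)
open import Level using (Level; _⊔_) renaming (suc to lsuc)
open import Relation.Binary.Bundles using (Setoid)
open import Relation.Binary.Core using (Rel)
open import Relation.Binary.Definitions
  using (Decidable; Symmetric; Irreflexive; _Respects_; _Respects₂_)
open import Relation.Binary.PropositionalEquality as ≡ using (_≡_; _≢_)
import Relation.Binary.Reasoning.Setoid as SetoidReasoning
open import Relation.Nullary.Decidable
  using (Dec; does; yes; no; map′; ¬?; _×-dec_; _→-dec_)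
open import Relation.Nullary.Negation using (¬_; contradiction)
import Relation.Unary as U
open U using (Pred; _∈_; _≐_; _∩_)

private
  variable
    a c ℓ ℓ₁ ℓ₂ m ℓm v ℓv ℓe : Level

HasOrder : Setoid a ℓ → ℕ → Set (a ⊔ ℓ)
HasOrder S k = Inverse (≡.setoid (Fin k)) S

Finite : Setoid a ℓ → Set (a ⊔ ℓ)
Finite S = ∃ (HasOrder S)

module _ (S : Setoid a ℓ) where
  open Setoid S

  finite-≟ : Finite S → Decidable _≈_
  finite-≟ (_ , enum) x y = map′
    (λ eq → trans (sym (strictlyInverseˡ x)) (trans (to-cong eq) (strictlyInverseˡ y)))
    from-cong
    (from x ≟ from y)
    where open Inverse enum

  finite-any? : Finite S → ∀ {p} {P : Pred Carrier p} →
                P Respects _≈_ → U.Decidable P → Dec (∃ P)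
  finite-any? (_ , enum) resp P? = map′
    (λ (i , pi) → to i , pi)
    (λ (x , px) → from x , resp (sym (strictlyInverseˡ x)) px)
    (any? (P? ∘ to))
    where open Inverse enum

  tuple : ((q , _) : Finite S) → ∀ {k} → Fin (q ℕ.^ k) → Vector Carrier k
  tuple (_ , enum) i = Inverse.to enum ∘ finToFun i

  tuple-surjective : (fin : Finite S) → ∀ {k} (x : Vector Carrier k) →
                     ∃ λ i → ∀ j → tuple fin i j ≈ x j
  tuple-surjective (_ , enum) x =
      funToFin (from ∘ x)
    , λ j → trans (to-cong (finToFun-funToFin (from ∘ x) j)) (strictlyInverseˡ (x j))
    where open Inverse enum

  module _ (_≈?_ : Decidable _≈_) where

    private
      nub : ∀ {k} (f : Fin k → Maybe Carrier) →
            ∃ λ l → Σ (Vector Carrier l) λ g →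
              (∀ {i j} → g i ≈ g j → i ≡ j) ×
              (∀ {i x} → f i ≡ just x → ∃ λ j → g j ≈ x)
      nub {ℕ.zero} f = 0 , (λ ()) , (λ { {()} }) , λ { {()} }
      nub {ℕ.suc k} f with nub (f ∘ suc) | f zero in eq
      ... | l , g , inj , cov | nothing = l , g , inj ,
        λ { {zero} e → contradiction (≡.trans (≡.sym eq) e) λ ()
          ; {suc i} e → cov e }
      ... | l , g , inj , cov | just x with any? (λ j → g j ≈? x)
      ...   | yes (j , gj≈x) = l , g , inj ,
        λ { {zero} e → j , trans gj≈x (just⇒≈ (≡.trans (≡.sym eq) e))
          ; {suc i} e → cov e }
        where
        just⇒≈ : ∀ {y z} → just y ≡ just z → y ≈ z
        just⇒≈ ≡.refl = refl
      ...   | no ¬gj≈x = ℕ.suc l , x ∷ g ,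
        (λ { {zero}  {zero}  _ → ≡.refl
           ; {zero}  {suc j} e → contradiction (j , sym e) ¬gj≈x
           ; {suc i} {zero}  e → contradiction (i , e) ¬gj≈x
           ; {suc i} {suc j} e → ≡.cong suc (inj e) }) ,
        λ { {zero} e → zero , just⇒≈ (≡.trans (≡.sym eq) e)
          ; {suc i} e → let j , p = cov e in suc j , p }
        where
        just⇒≈ : ∀ {y z} → just y ≡ just z → y ≈ z
        just⇒≈ ≡.refl = refl

    finite-from-covering : ∀ {k} (f : Fin k → Maybe Carrier) →
      (∀ x → ∃₂ λ i y → f i ≡ just y × y ≈ x) → Finite S
    finite-from-covering f covers with nub f
    ... | l , g , inj , cov = l , record
      { to        = g
      ; from      = index
      ; to-cong   = λ { ≡.refl → refl }
      ; from-cong = λ {x} {y} x≈y →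
          inj (trans (g-index x) (trans x≈y (sym (g-index y))))
      ; inverse   = (λ { {x} ≡.refl → g-index x }) ,
                    (λ {i} {x} x≈gi → inj (trans (g-index x) x≈gi))
      }
      where
      indexed : ∀ x → ∃ λ j → g j ≈ x
      indexed x = let _ , _ , fi≡y , y≈x = covers x
                      j , gj≈y = cov fi≡y
                  in j , trans gj≈y y≈x
      index : Carrier → Fin l
      index x = proj₁ (indexed x)
      g-index : ∀ x → g (index x) ≈ x
      g-index x = proj₂ (indexed x)

-- The library's HeytingField is the constructive notion of field; on a
-- finite carrier the apartness x # y is equivalent to ¬ (x ≈ y).

fieldRing : HeytingField c ℓ₁ ℓ₂ → CommutativeRing c ℓ₁
fieldRing F =
  HeytingCommutativeRing.commutativeRing (HeytingField.heytingCommutativeRing F)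

VectorSpace : HeytingField c ℓ₁ ℓ₂ → (m ℓm : Level) → Set _
VectorSpace F m ℓm = Module (fieldRing F) m ℓm

module LinearAlgebra (F : HeytingField c ℓ₁ ℓ₂) (V : VectorSpace F m ℓm) where

  private
    module F = CommutativeRing (fieldRing F)
    module FP = AbelianGroupProperties F.+-abelianGroup
  open Module V
  open Sum +ᴹ-commutativeMonoid using (sum; sum-cong-≋; ∑-distrib-+; sum-replicate-zero)
  private
    module VP = AbelianGroupProperties +ᴹ-abelianGroup

  vectors : Setoid m ℓm
  vectors = ≈ᴹ-setoid

  combination : ∀ {k} → Vector F.Carrier k → Vector Carrierᴹ k → Carrierᴹ
  combination α b = sum (λ i → α i *ₗ b i)

  LinearlyIndependent : ∀ {k} → Vector Carrierᴹ k → Set _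
  LinearlyIndependent b = ∀ α → combination α b ≈ᴹ 0ᴹ → ∀ i → α i F.≈ F.0#

  record IsBasis {p} (P : Pred Carrierᴹ p) {k} (b : Vector Carrierᴹ k)
                 : Set (c ⊔ ℓ₁ ⊔ m ⊔ ℓm ⊔ p) where
    field
      members     : ∀ i → b i ∈ P
      independent : LinearlyIndependent b
      spanning    : ∀ {x} → x ∈ P → ∃ λ α → x ≈ᴹ combination α b

  HasDimension : ∀ {p} → Pred Carrierᴹ p → ℕ → Set _
  HasDimension P k = Σ (Vector Carrierᴹ k) (IsBasis P)

  -- The level c ⊔ ℓm is that of a span, so no finite-dimensional subspace is
  -- lost up to ≐.

  record Subspace : Set (lsuc (c ⊔ ℓm) ⊔ m) where
    field
      member    : Pred Carrierᴹ (c ⊔ ℓm)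
      ≈-closed  : member Respects _≈ᴹ_
      0-closed  : 0ᴹ ∈ member
      +-closed  : ∀ {x y} → x ∈ member → y ∈ member → (x +ᴹ y) ∈ member
      *-closed  : ∀ {x} (α : F.Carrier) → x ∈ member → (α *ₗ x) ∈ member

  open Subspace public using (member)

  Grassmannian : ℕ → Setoid _ _
  Grassmannian k = record
    { Carrier       = Σ Subspace (λ U → HasDimension (member U) k)
    ; _≈_           = λ (U , _) (W , _) → member U ≐ member W
    ; isEquivalence = record
      { refl  = (λ x → x) , (λ x → x)
      ; sym   = λ (f , g) → g , f
      ; trans = λ (f , g) (h , k) → h ∘ f , g ∘ k
      }
    }

  combination-cong : ∀ {k} {α β : Vector F.Carrier k} {b b′ : Vector Carrierᴹ k} →
    (∀ i → α i F.≈ β i) → (∀ i → b i ≈ᴹ b′ i) → combination α b ≈ᴹ combination β b′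
  combination-cong α≈β b≈b′ = sum-cong-≋ (λ i → *ₗ-cong (α≈β i) (b≈b′ i))

  combination-+ : ∀ {k} (α β : Vector F.Carrier k) (b : Vector Carrierᴹ k) →
    combination (λ i → α i F.+ β i) b ≈ᴹ combination α b +ᴹ combination β b
  combination-+ α β b =
    ≈ᴹ-trans (sum-cong-≋ (λ i → *ₗ-distribʳ (b i) (α i) (β i)))
             (∑-distrib-+ (λ i → α i *ₗ b i) (λ i → β i *ₗ b i))

  combination-* : ∀ {k} γ (α : Vector F.Carrier k) (b : Vector Carrierᴹ k) →
    combination (λ i → γ F.* α i) b ≈ᴹ γ *ₗ combination α b
  combination-* {ℕ.zero}  γ α b = ≈ᴹ-sym (*ₗ-zeroʳ γ)
  combination-* {ℕ.suc k} γ α b =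
    ≈ᴹ-trans (+ᴹ-cong (*ₗ-assoc γ (α zero) (b zero))
                      (combination-* γ (α ∘ suc) (b ∘ suc)))
             (≈ᴹ-sym (*ₗ-distribˡ γ (α zero *ₗ b zero) (combination (α ∘ suc) (b ∘ suc))))

  combination-0 : ∀ {k} (b : Vector Carrierᴹ k) → combination (λ _ → F.0#) b ≈ᴹ 0ᴹ
  combination-0 {k} b =
    ≈ᴹ-trans (sum-cong-≋ (λ i → *ₗ-zeroˡ (b i))) (sum-replicate-zero k)

  span : ∀ {k} → Vector Carrierᴹ k → Subspace
  span b = record
    { member   = λ x → ∃ λ α → x ≈ᴹ combination α b
    ; ≈-closed = λ x≈y (α , eq) → α , ≈ᴹ-trans (≈ᴹ-sym x≈y) eq
    ; 0-closed = (λ _ → F.0#) , ≈ᴹ-sym (combination-0 b)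
    ; +-closed = λ (α , p) (β , r) →
        (λ i → α i F.+ β i) , ≈ᴹ-trans (+ᴹ-cong p r) (≈ᴹ-sym (combination-+ α β b))
    ; *-closed = λ γ (α , p) →
        (λ i → γ F.* α i) , ≈ᴹ-trans (*ₗ-cong F.refl p) (≈ᴹ-sym (combination-* γ α b))
    }

  combination-closed : ∀ (U : Subspace) {k} α {b : Vector Carrierᴹ k} →
    (∀ i → b i ∈ member U) → combination α b ∈ member U
  combination-closed U {ℕ.zero}  α b∈U = Subspace.0-closed U
  combination-closed U {ℕ.suc k} α b∈U = Subspace.+-closed U
    (Subspace.*-closed U (α zero) (b∈U zero))
    (combination-closed U (α ∘ suc) (b∈U ∘ suc))

  unit : ∀ {k} → Fin k → Vector F.Carrier k
  unit zero    = F.1# ∷ λ _ → F.0#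
  unit (suc i) = F.0# ∷ unit i

  combination-unit : ∀ {k} (b : Vector Carrierᴹ k) i → combination (unit i) b ≈ᴹ b i
  combination-unit b zero =
    ≈ᴹ-trans (+ᴹ-cong (*ₗ-identityˡ (b zero)) (combination-0 (b ∘ suc)))
             (+ᴹ-identityʳ (b zero))
  combination-unit b (suc i) =
    ≈ᴹ-trans (+ᴹ-cong (*ₗ-zeroˡ (b zero)) (combination-unit (b ∘ suc) i))
             (+ᴹ-identityˡ (b (suc i)))

  span-isBasis : ∀ {k} {b : Vector Carrierᴹ k} →
                 LinearlyIndependent b → IsBasis (member (span b)) b
  span-isBasis {b = b} ind = record
    { members     = λ i → unit i , ≈ᴹ-sym (combination-unit b i)
    ; independent = ind
    ; spanning    = λ x∈ → x∈
    }

  independent⇒injective : ∀ {k} {b : Vector Carrierᴹ k} → LinearlyIndependent b →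
    ∀ α β → combination α b ≈ᴹ combination β b → ∀ i → α i F.≈ β i
  independent⇒injective {b = b} ind α β eq i =
    FP.x∙y⁻¹≈ε⇒x≈y (α i) (β i) (ind γ γb≈0 i)
    where
    γ = λ j → α j F.+ F.- β j
    open SetoidReasoning ≈ᴹ-setoid
    γb≈0 : combination γ b ≈ᴹ 0ᴹ
    γb≈0 = VP.∙-cancelʳ (combination β b) _ _ (begin
      combination γ b +ᴹ combination β b       ≈⟨ combination-+ γ β b ⟨
      combination (λ j → γ j F.+ β j) b        ≈⟨ combination-cong (λ j → FP.//-rightDividesˡ (β j) (α j)) (λ _ → ≈ᴹ-refl) ⟩
      combination α b                          ≈⟨ eq ⟩
      combination β b                          ≈⟨ +ᴹ-identityˡ _ ⟨
      0ᴹ +ᴹ combination β b                    ∎)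

  module _ (F-finite : Finite F.setoid) where

    private
      scalars : ∀ {k} → Fin (proj₁ F-finite ℕ.^ k) → Vector F.Carrier k
      scalars = tuple F.setoid F-finite

    module _ {n : ℕ} (V-dim : HasDimension (U.U {A = Carrierᴹ}) n) where

      -- Abstract only to keep types involving the enumeration of the
      -- Grassmannian small: every property needed is in these types.

      abstract

        vectors-≟ : Decidable _≈ᴹ_
        vectors-≟ x y =
          map′ (λ α≈β → ≈ᴹ-trans (proj₂ (coords x))
                 (≈ᴹ-trans (combination-cong α≈β (λ _ → ≈ᴹ-refl)) (≈ᴹ-sym (proj₂ (coords y)))))
               (λ x≈y → independent⇒injective independent _ _
                 (≈ᴹ-trans (≈ᴹ-sym (proj₂ (coords x))) (≈ᴹ-trans x≈y (proj₂ (coords y)))))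
               (all? (λ i → finite-≟ F.setoid F-finite (proj₁ (coords x) i) (proj₁ (coords y) i)))
          where
          open IsBasis (proj₂ V-dim)
          coords : ∀ x → ∃ λ α → x ≈ᴹ combination α (proj₁ V-dim)
          coords x = spanning {x} _

        vectors-finite : Finite vectors
        vectors-finite = finite-from-covering vectors vectors-≟
          (λ i → just (combination (scalars {n} i) (proj₁ V-dim)))
          (λ x → let α , x≈ = IsBasis.spanning (proj₂ V-dim) {x} _
                     i , eq = tuple-surjective F.setoid F-finite α
                 in i , _ , ≡.refl ,
                    ≈ᴹ-trans (combination-cong eq (λ _ → ≈ᴹ-refl)) (≈ᴹ-sym x≈))

        independent? : ∀ {k} (b : Vector Carrierᴹ k) → Dec (LinearlyIndependent b)
        independent? {k} b =
          map′ (λ h α αb≈0 i →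
                 let j , eq = tuple-surjective F.setoid F-finite α
                 in F.trans (F.sym (eq i))
                      (h j (≈ᴹ-trans (combination-cong eq (λ _ → ≈ᴹ-refl)) αb≈0) i))
               (λ ind j → ind (scalars j))
               (all? (λ j → vectors-≟ (combination (scalars {k} j) b) 0ᴹ
                            →-dec all? (λ i → finite-≟ F.setoid F-finite (scalars {k} j i) F.0#)))

        ∈-span? : ∀ {k} (b : Vector Carrierᴹ k) → U.Decidable (member (span b))
        ∈-span? {k} b x =
          map′ (λ (j , eq) → scalars j , eq)
               (λ (α , x≈) → let j , eq = tuple-surjective F.setoid F-finite α
                  in j , ≈ᴹ-trans x≈ (combination-cong (λ i → F.sym (eq i)) (λ _ → ≈ᴹ-refl)))
               (any? (λ j → vectors-≟ x (combination (scalars {k} j) b)))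

        ∈? : ∀ {k} ((U , _) : Setoid.Carrier (Grassmannian k)) → U.Decidable (member U)
        ∈? (U , b , isBasis) x =
          map′ (λ (α , x≈) → Subspace.≈-closed U (≈ᴹ-sym x≈) (combination-closed U α members))
               spanning
               (∈-span? b x)
          where open IsBasis isBasis

        Grassmannian-≟ : ∀ {k} → Decidable (Setoid._≈_ (Grassmannian k))
        Grassmannian-≟ {k} U W = ⊆? U W ×-dec ⊆? W U
          where
          open Inverse (proj₂ vectors-finite) using (to; from; strictlyInverseˡ)
          ⊆? : ∀ (U W : Setoid.Carrier (Grassmannian k)) → Dec (member (proj₁ U) U.⊆ member (proj₁ W))
          ⊆? U W = map′
            (λ h {x} x∈U → Subspace.≈-closed (proj₁ W) (strictlyInverseˡ x)
              (h (from x) (Subspace.≈-closed (proj₁ U) (≈ᴹ-sym (strictlyInverseˡ x)) x∈U)))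
            (λ h i → h)
            (all? (λ i → ∈? U (to i) →-dec ∈? W (to i)))

        Grassmannian-finite : ∀ k → Finite (Grassmannian k)
        Grassmannian-finite k =
          finite-from-covering (Grassmannian k) Grassmannian-≟ spanOf covers
          where
          tuples : Fin (proj₁ vectors-finite ℕ.^ k) → Vector Carrierᴹ k
          tuples = tuple vectors vectors-finite

          spanned : (b : Vector Carrierᴹ k) → Dec (LinearlyIndependent b) →
                    Maybe (Setoid.Carrier (Grassmannian k))
          spanned b (yes ind) = just (span b , b , span-isBasis ind)
          spanned b (no _)    = nothing

          spanOf : Fin (proj₁ vectors-finite ℕ.^ k) → Maybe (Setoid.Carrier (Grassmannian k))
          spanOf i = spanned (tuples i) (independent? (tuples i))

          covers : ∀ U → ∃₂ λ i W → spanOf i ≡ just W × Setoid._≈_ (Grassmannian k) W U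
          covers (U , b , isBasis) =
            let i , eq = tuple-surjective vectors vectors-finite b
                ind = λ α e → IsBasis.independent isBasis α
                        (≈ᴹ-trans (combination-cong (λ _ → F.refl) (λ j → ≈ᴹ-sym (eq j))) e)
                W , p , q = isSpanned (tuples i) ind (independent? (tuples i))
            in i , W , p ,
               ( (λ x∈W → let α , x≈ = proj₁ q x∈W in
                    Subspace.≈-closed U (≈ᴹ-sym x≈) (combination-closed U α
                      (λ j → Subspace.≈-closed U (≈ᴹ-sym (eq j)) (IsBasis.members isBasis j))))
               , (λ x∈U → let α , x≈ = IsBasis.spanning isBasis x∈U in
                    proj₂ q (α , ≈ᴹ-trans x≈
                      (combination-cong (λ _ → F.refl) (λ j → ≈ᴹ-sym (eq j))))) )
            where
            isSpanned : ∀ b → LinearlyIndependent b → (d : Dec (LinearlyIndependent b)) →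
              ∃ λ W → spanned b d ≡ just W × (member (proj₁ W) ≐ member (span b))
            isSpanned b ind (yes _)   = _ , ≡.refl , (λ x → x) , (λ x → x)
            isSpanned b ind (no ¬ind) = contradiction ind ¬ind

record FiniteGraph v ℓv ℓe : Set (lsuc (v ⊔ ℓv ⊔ ℓe)) where
  field
    vertices    : Setoid v ℓv
    order       : ℕ
    enumeration : HasOrder vertices order

  open Setoid vertices using (Carrier; _≈_)

  field
    _~_      : Rel Carrier ℓe
    ~-resp-≈ : _~_ Respects₂ _≈_
    ~-sym    : Symmetric _~_
    ~-irrefl : Irreflexive _≈_ _~_
    _~?_     : Decidable _~_

  vertex : Fin order → Carrier
  vertex = Inverse.to enumeration

  degree : Fin order → ℕ
  degree i = length (filter (λ j → vertex i ~? vertex j) (allFin order))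

  HasValency : ℕ → Set
  HasValency k = ∀ i → degree i ≡ k

module _ (F : HeytingField c ℓ₁ ℓ₂) (V : VectorSpace F m ℓm) where
  open LinearAlgebra F V
  open Module V

  grassmannGraph : ∀ {n} → Finite (CommutativeRing.setoid (fieldRing F)) →
                   HasDimension (U.U {A = Carrierᴹ}) n → FiniteGraph _ _ _
  grassmannGraph F-finite V-dim = record
    { vertices    = Grassmannian 2
    ; order       = proj₁ (Grassmannian-finite F-finite V-dim 2)
    ; enumeration = proj₂ (Grassmannian-finite F-finite V-dim 2)
    ; _~_         = _~_
    ; ~-resp-≈    =
        (λ (W⊆W′ , W′⊆W) (U≉W , x , x≉0 , x∈U , x∈W) →
          (λ (U⊆W′ , W′⊆U) → U≉W ((W′⊆W ∘ U⊆W′) , (W′⊆U ∘ W⊆W′))) ,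
          x , x≉0 , x∈U , W⊆W′ x∈W)
      , (λ (U⊆U′ , U′⊆U) (U≉W , x , x≉0 , x∈U , x∈W) →
          (λ (U′⊆W , W⊆U′) → U≉W ((U′⊆W ∘ U⊆U′) , (U′⊆U ∘ W⊆U′))) ,
          x , x≉0 , U⊆U′ x∈U , x∈W)
    ; ~-sym       = λ (U≉W , x , x≉0 , x∈U , x∈W) →
        (λ (W⊆U , U⊆W) → U≉W (U⊆W , W⊆U)) , x , x≉0 , x∈W , x∈U
    ; ~-irrefl    = λ U≈W (U≉W , _) → U≉W U≈W
    ; _~?_        = λ U W →
        ¬? (Grassmannian-≟ F-finite V-dim U W) ×-dec
        finite-any? vectors (vectors-finite F-finite V-dim)
          (λ x≈y (x≉0 , x∈U , x∈W) →
            (λ y≈0 → x≉0 (≈ᴹ-trans x≈y y≈0)) ,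
            Subspace.≈-closed (proj₁ U) x≈y x∈U , Subspace.≈-closed (proj₁ W) x≈y x∈W)
          (λ x → ¬? (vectors-≟ F-finite V-dim x 0ᴹ) ×-dec
                 (∈? F-finite V-dim U x ×-dec ∈? F-finite V-dim W x))
    }
    where
    _~_ : Rel (Setoid.Carrier (Grassmannian 2)) _
    U ~ W = ¬ (member (proj₁ U) ≐ member (proj₁ W)) ×
            ∃ λ x → x ≉ᴹ 0ᴹ × x ∈ member (proj₁ U) ∩ member (proj₁ W)

Matrix : ℕ → Set
Matrix N = Fin N → Fin N → ℤ

module ℤSum = SemiringSum ℤ.+-*-semiring
open ℤSum using () renaming (sum to ∑ℤ)

infixl 7 _⊗_
infix 4 _≋_

_≋_ : ∀ {N} → Rel (Matrix N) _
A ≋ B = ∀ i j → A i j ≡ B i j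

_⊗_ : ∀ {N} → Matrix N → Matrix N → Matrix N
(A ⊗ B) i j = ∑ℤ (λ k → A i k ℤ.* B k j)

diagonal : ∀ {N} → Vector ℤ N → Matrix N
diagonal d i j = if does (i ≟ j) then d i else 0ℤ

identity : ∀ {N} → Matrix N
identity = diagonal (λ _ → 1ℤ)

Unimodular : ∀ {N} → Matrix N → Set
Unimodular A = ∃ λ B → (A ⊗ B ≋ identity) × (B ⊗ A ≋ identity)

record SmithForm {N} (A : Matrix N) : Set where
  field
    P Q          : Matrix N
    P-unimodular : Unimodular P
    Q-unimodular : Unimodular Q
    invariant    : Vector ℕ N
    isDiagonal   : P ⊗ A ⊗ Q ≋ diagonal (+_ ∘ invariant)
    divides      : ∀ {i j} → toℕ i ℕ.≤ toℕ j → invariant i ∣ invariant j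

-- The p-elementary divisors of A are the exact powers p ^ e of p dividing its
-- nonzero invariant factors; the nontrivial ones have e ≢ 0.

record ElementaryDivisor {N} (A : Matrix N) (p e : ℕ) : Set where
  field
    smith     : SmithForm A
    index     : Fin N
    nonzero   : SmithForm.invariant smith index ≢ 0
    divides   : p ℕ.^ e ∣ SmithForm.invariant smith index
    maximal   : ¬ (p ℕ.^ ℕ.suc e ∣ SmithForm.invariant smith index)

module _ (Γ : FiniteGraph v ℓv ℓe) where
  open FiniteGraph Γ

  adjacencyMatrix : Matrix order
  adjacencyMatrix i j = if does (vertex i ~? vertex j) then 1ℤ else 0ℤ

  laplacian : ℕ → Matrix order
  laplacian k i j = (+ k) ℤ.* identity i j ℤ.- adjacencyMatrix i j

ℤ^ : ℕ → AbelianGroup _ _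
ℤ^ N = Pointwise.abelianGroup (Fin N) ℤ.+-0-abelianGroup

module _ (G : AbelianGroup a ℓ) where
  open AbelianGroup G
  open AbelianGroupProperties G
  open Mult commutativeMonoid renaming (_×_ to _·_)
  open SetoidReasoning setoid

  private
    interchange : ∀ w x y z → (w ∙ x) ∙ (y ∙ z) ≈ (w ∙ y) ∙ (x ∙ z)
    interchange w x y z = begin
      (w ∙ x) ∙ (y ∙ z) ≈⟨ assoc w x (y ∙ z) ⟩
      w ∙ (x ∙ (y ∙ z)) ≈⟨ ∙-congˡ (assoc x y z) ⟨
      w ∙ ((x ∙ y) ∙ z) ≈⟨ ∙-congˡ (∙-congʳ (comm x y)) ⟩
      w ∙ ((y ∙ x) ∙ z) ≈⟨ ∙-congˡ (assoc y x z) ⟩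
      w ∙ (y ∙ (x ∙ z)) ≈⟨ assoc w y (x ∙ z) ⟨
      (w ∙ y) ∙ (x ∙ z) ∎

    ·-ε : ∀ n → n · ε ≈ ε
    ·-ε ℕ.zero    = refl
    ·-ε (ℕ.suc n) = trans (identityˡ (n · ε)) (·-ε n)

    ·-⁻¹ : ∀ n x → n · (x ⁻¹) ≈ (n · x) ⁻¹
    ·-⁻¹ n x = inverseˡ-unique _ _ (begin
      n · (x ⁻¹) ∙ n · x ≈⟨ ×-distrib-+ (x ⁻¹) x n ⟨
      n · (x ⁻¹ ∙ x)     ≈⟨ ×-congʳ n (inverseˡ x) ⟩
      n · ε              ≈⟨ ·-ε n ⟩
      ε                  ∎)

  module _ {f : Carrier → Carrier} (f-hom : IsGroupHomomorphism rawGroup rawGroup f) where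
    open IsGroupHomomorphism f-hom

    cokernel : AbelianGroup a (a ⊔ ℓ)
    cokernel = record
      { Carrier = Carrier
      ; _≈_     = λ x y → ∃ λ z → x - y ≈ f z
      ; _∙_     = _∙_
      ; ε       = ε
      ; _⁻¹     = _⁻¹
      ; isAbelianGroup = record
        { isGroup = record
          { isMonoid = record
            { isSemigroup = record
              { isMagma = record
                { isEquivalence = record
                  { refl  = fromEq refl
                  ; sym   = λ {x} {y} (z , eq) → z ⁻¹ , (begin
                      y - x      ≈⟨ ⁻¹-anti-homo‿- x y ⟨
                      (x - y) ⁻¹ ≈⟨ ⁻¹-cong eq ⟩
                      (f z) ⁻¹   ≈⟨ ⁻¹-homo z ⟨
                      f (z ⁻¹)   ∎)
                  ; trans = λ {x} {y} {w} (z , p) (z′ , q) → z ∙ z′ , (begin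
                      x - w                 ≈⟨ ∙-congʳ (//-rightDividesˡ y x) ⟨
                      ((x - y) ∙ y) ∙ w ⁻¹  ≈⟨ assoc (x - y) y (w ⁻¹) ⟩
                      (x - y) ∙ (y - w)     ≈⟨ ∙-cong p q ⟩
                      f z ∙ f z′            ≈⟨ homo z z′ ⟨
                      f (z ∙ z′)            ∎)
                  }
                ; ∙-cong = λ {x} {y} {u} {w} (z , p) (z′ , q) → z ∙ z′ , (begin
                      (x ∙ u) ∙ (y ∙ w) ⁻¹     ≈⟨ ∙-congˡ (⁻¹-∙-comm y w) ⟨
                      (x ∙ u) ∙ (y ⁻¹ ∙ w ⁻¹)  ≈⟨ interchange x u (y ⁻¹) (w ⁻¹) ⟩
                      (x - y) ∙ (u - w)        ≈⟨ ∙-cong p q ⟩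
                      f z ∙ f z′               ≈⟨ homo z z′ ⟨
                      f (z ∙ z′)               ∎)
                }
              ; assoc = λ x y z → fromEq (assoc x y z)
              }
            ; identity = (λ x → fromEq (identityˡ x)) , (λ x → fromEq (identityʳ x))
            }
          ; inverse = (λ x → fromEq (inverseˡ x)) , (λ x → fromEq (inverseʳ x))
          ; ⁻¹-cong = λ {x} {y} (z , p) → z ⁻¹ , (begin
              x ⁻¹ ∙ (y ⁻¹) ⁻¹ ≈⟨ ⁻¹-∙-comm x (y ⁻¹) ⟩
              (x - y) ⁻¹       ≈⟨ ⁻¹-cong p ⟩
              (f z) ⁻¹         ≈⟨ ⁻¹-homo z ⟨
              f (z ⁻¹)         ∎)
          }
        ; comm = λ x y → fromEq (comm x y)
        }
      }
      where
      fromEq : ∀ {x y} → x ≈ y → ∃ λ z → x - y ≈ f z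
      fromEq x≈y = ε , trans (x≈y⇒x∙y⁻¹≈ε x≈y) (sym ε-homo)

  Torsion : Pred Carrier ℓ
  Torsion x = ∃ λ n → NonZero n × n · x ≈ ε

  torsionSubgroup : AbelianGroup (a ⊔ ℓ) ℓ
  torsionSubgroup = record
    { Carrier = ∃ Torsion
    ; _≈_     = _≈_ on proj₁
    ; _∙_     = λ (x , n , n≢0 , nx≈ε) (y , k , k≢0 , ky≈ε) →
        x ∙ y , n ℕ.* k , ℕ.m*n≢0 n k {{n≢0}} {{k≢0}} , (begin
          (n ℕ.* k) · (x ∙ y)              ≈⟨ ×-distrib-+ x y (n ℕ.* k) ⟩
          (n ℕ.* k) · x ∙ (n ℕ.* k) · y    ≈⟨ ∙-congʳ (×-congˡ (ℕ.*-comm n k)) ⟩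
          (k ℕ.* n) · x ∙ (n ℕ.* k) · y    ≈⟨ ∙-cong (×-assocˡ x k n) (×-assocˡ y n k) ⟨
          k · (n · x) ∙ n · (k · y)        ≈⟨ ∙-cong (×-congʳ k nx≈ε) (×-congʳ n ky≈ε) ⟩
          k · ε ∙ n · ε                    ≈⟨ ∙-cong (·-ε k) (·-ε n) ⟩
          ε ∙ ε                            ≈⟨ identityˡ ε ⟩
          ε                                ∎)
    ; ε       = ε , 1 , _ , ·-ε 1
    ; _⁻¹     = λ (x , n , n≢0 , nx≈ε) → x ⁻¹ , n , n≢0 ,
        trans (·-⁻¹ n x) (trans (⁻¹-cong nx≈ε) ε⁻¹≈ε)
    ; isAbelianGroup = record
      { isGroup = record
        { isMonoid = record
          { isSemigroup = record
            { isMagma = record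
              { isEquivalence = record { refl = refl ; sym = sym ; trans = trans }
              ; ∙-cong        = ∙-cong
              }
            ; assoc = λ x y z → assoc (proj₁ x) (proj₁ y) (proj₁ z)
            }
          ; identity = (λ x → identityˡ (proj₁ x)) , (λ x → identityʳ (proj₁ x))
          }
        ; inverse = (λ x → inverseˡ (proj₁ x)) , (λ x → inverseʳ (proj₁ x))
        ; ⁻¹-cong = ⁻¹-cong
        }
      ; comm = λ x y → comm (proj₁ x) (proj₁ y)
      }
    }

infixr 7 _⊛_

_⊛_ : ∀ {N} → Matrix N → Vector ℤ N → Vector ℤ N
(A ⊛ x) i = ∑ℤ (λ j → A i j ℤ.* x j)

⊛-isGroupHomomorphism : ∀ {N} (A : Matrix N) →
  IsGroupHomomorphism (AbelianGroup.rawGroup (ℤ^ N)) (AbelianGroup.rawGroup (ℤ^ N)) (A ⊛_)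
⊛-isGroupHomomorphism {N} A = record
  { isMonoidHomomorphism = record
    { isMagmaHomomorphism = record
      { isRelHomomorphism = record { cong = ⊛-cong }
      ; homo = ⊛-+
      }
    ; ε-homo = ⊛-0
    }
  ; ⁻¹-homo = λ x → AbelianGroupProperties.inverseˡ-unique (ℤ^ N) _ _
      (λ i → ≡.trans (≡.sym (⊛-+ (ℤ.-_ ∘ x) x i))
               (≡.trans (⊛-cong (λ j → ℤ.+-inverseˡ (x j)) i) (⊛-0 i)))
  }
  where
  ⊛-cong : ∀ {x y} → (∀ i → x i ≡ y i) → ∀ i → (A ⊛ x) i ≡ (A ⊛ y) i
  ⊛-cong x≗y i = ℤSum.sum-cong-≗ (λ j → ≡.cong (A i j ℤ.*_) (x≗y j))

  ⊛-+ : ∀ x y i → (A ⊛ (λ j → x j ℤ.+ y j)) i ≡ (A ⊛ x) i ℤ.+ (A ⊛ y) i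
  ⊛-+ x y i = ≡.trans
    (ℤSum.sum-cong-≗ (λ j → ℤ.*-distribˡ-+ (A i j) (x j) (y j)))
    (ℤSum.∑-distrib-+ (λ j → A i j ℤ.* x j) (λ j → A i j ℤ.* y j))

  ⊛-0 : ∀ i → (A ⊛ (λ _ → 0ℤ)) i ≡ 0ℤ
  ⊛-0 i = ≡.trans (ℤSum.sum-cong-≗ (λ j → ℤ.*-zeroʳ (A i j))) (ℤSum.sum-replicate-zero N)

criticalGroup : ∀ {N} → Matrix N → AbelianGroup _ _
criticalGroup {N} L = torsionSubgroup (cokernel (ℤ^ N) (⊛-isGroupHomomorphism L))

{-# OPTIONS --safe #-}

-- Let C be the matrix indexed by pairs of lines whose entries count common
-- nonzero vectors, so that C = (q² - 1) I + (q - 1) A. Two independent vectors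
-- lie on one line, and the number N of lines through a nonzero vector
-- satisfies (q - 1) N = q^(n-1) - 1; hence C² = (q² - 1)² J + g C with
-- g = q^(n-1) - q. If f denotes the row sum of C, then (q - 1) L = f I - C, and
-- on zero-sum vectors (q - 1) L ((f - g) I + C) = f (f - g). Since
-- (q - 1) f = (q² - 1) (q^(n-1) - 1) ≡ 1 and g ≡ 0 modulo p, the torsion of the
-- cokernel of L is annihilated by an integer f (f - g) prime to p.

module Submission where

open import Defs
open import Algebra.Apartness.Bundles using (HeytingField)
import Algebra.Apartness.Properties.HeytingCommutativeRing as HeytingProperties
open import Algebra.Bundles using (AbelianGroup; CommutativeRing)
open import Algebra.Module.Bundles using (Module)
open import Algebra.Morphism.Structures using (IsGroupHomomorphism)
import Algebra.Properties.AbelianGroup as AbelianGroupProperties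
import Algebra.Properties.CommutativeMonoid.Mult as Mult
open import Data.Bool.Base using (true; false; if_then_else_)
open import Data.Fin.Base
  using (Fin; zero; suc; toℕ; fromℕ<; combine; remQuot; finToFun; funToFin)
open import Data.Fin.Properties
  using (_≟_; any?; all?; toℕ<n; toℕ-fromℕ<; toℕ-injective; combine-remQuot; remQuot-combine;
         finToFun-funToFin; funToFin-finToFin)
open import Data.Integer.Base as ℤ using (ℤ; 0ℤ; 1ℤ; +_; -[1+_]; _%ℕ_; _/ℕ_)
open import Data.Integer.DivMod using (n%ℕd<d; a≡a%ℕn+[a/ℕn]*n)
open import Data.Integer.Divisibility.Signed as ℤ∣ using (divides)
import Data.Integer.Properties as ℤ
open import Data.Integer.Tactic.RingSolver using (solve-∀)
open import Data.List.Base using (length; filter; tabulate)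
open import Data.Nat.Base as ℕ using (ℕ; NonZero; _^_; _≤_)
open import Data.Nat.Divisibility as ℕ∣ using (_∣_)
open import Data.Nat.Induction using (<-rec)
open import Data.Nat.Primality using (Prime; euclidsLemma; prime⇒nonTrivial; prime⇒nonZero)
import Data.Nat.Properties as ℕ
open import Data.Product.Base using (∃; _×_; _,_; proj₁; proj₂)
open import Data.Sum.Base using ([_,_]′)
open import Data.Unit.Base using (tt)
open import Data.Vec.Functional using (Vector; _∷_)
open import Function.Base using (_∘_)
open import Function.Bundles using (Inverse; mk⇔)
open import Level using (0ℓ; Level)
open import Relation.Binary.Bundles using (Setoid)
open import Relation.Binary.Definitions using (_Respects_)
open import Relation.Binary.PropositionalEquality as ≡ using (_≡_; _≗_)
open import Relation.Nullary.Decidable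
  using (Dec; yes; no; map′; does; dec-true; dec-false; does-⇔; ¬?; _×-dec_; decidable-stable)
open import Relation.Nullary.Negation using (¬_; contradiction)
open import Relation.Unary as U using (Pred; U; _∈_; _∉_; _⊆_)
open ≡.≡-Reasoning

open ℤSum using () renaming (sum to ∑ℤ)

-- The conclusion asks for an explicit enumeration of the critical group, so annihilation by an
-- integer has to be turned into a count. Column sums of `L` are zero and ℤ has no torsion, so every
-- torsion class is zero-sum; conversely the annihilator d makes every zero-sum class torsion. The
-- torsion subgroup is therefore a quotient of a free group by a lattice containing d times that
-- group, and membership in this lattice can be decided modulo d; enumerating cosets one coordinate
-- at a time gives an order dividing a power of d. The same annihilator is divisible by every
-- nonzero invariant factor of a Smith form. On the geometric side, the number of lines through a
-- vector is determined only after multiplication by q - 1, which is why the relations carry this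
-- factor instead of dividing by it.

-- Subgroups of ℤ

module _ {I : Pred ℤ 0ℓ}
         (+-closed : ∀ {a b} → a ∈ I → b ∈ I → (a ℤ.+ b) ∈ I)
         (neg-closed : ∀ {a} → a ∈ I → (ℤ.- a) ∈ I) where

  multiple-closed : ∀ {a} q → a ∈ I → (q ℤ.* a) ∈ I
  multiple-closed {a} (+ n) a∈I = natural n
    where
    natural : ∀ n → (+ n ℤ.* a) ∈ I
    natural ℕ.zero    = ≡.subst I (ℤ.+-inverseʳ a) (+-closed a∈I (neg-closed a∈I))
    natural (ℕ.suc n) = ≡.subst I (≡.sym (ℤ.suc-* (+ n) a)) (+-closed a∈I (natural n))
  multiple-closed {a} -[1+ n ] a∈I =
    ≡.subst I (ℤ.neg-distribˡ-* (+ ℕ.suc n) a) (neg-closed (multiple-closed (+ ℕ.suc n) a∈I))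

  -- Descent on d: as long as a smaller positive integer lies in `I`, it replaces d; the minimal one
  -- divides every member by division with remainder.
  ideal-principal : U.Decidable I → ∀ d → NonZero d → (+ d) ∈ I →
                    ∃ λ m → NonZero m × (∀ {a} → a ∈ I → (+ m) ℤ∣.∣ a) × (+ m) ∈ I
  ideal-principal I? = <-rec _ step
    where
    step : ∀ d → (∀ {e} → e ℕ.< d → NonZero e → (+ e) ∈ I → _) → NonZero d → (+ d) ∈ I → _
    step d@(ℕ.suc d′) rec _ d∈I with any? (λ (i : Fin d′) → I? (+ ℕ.suc (toℕ i)))
    ... | yes (i , i∈I) = rec (ℕ.s<s (toℕ<n i)) _ i∈I
    ... | no  minimal   = d , _ , (λ {a} a∈I → divides (a /ℕ d) (exact a a∈I)) , d∈I
      where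
      exact : ∀ a → a ∈ I → a ≡ (a /ℕ d) ℤ.* + d
      exact a a∈I with a %ℕ d | n%ℕd<d a d | a≡a%ℕn+[a/ℕn]*n a d
      ... | ℕ.zero  | _         | eq = ≡.trans eq (ℤ.+-identityˡ _)
      ... | ℕ.suc r | ℕ.s≤s r<d′ | eq = contradiction (fromℕ< r<d′ , r∈I) minimal
        where
        cancel : ∀ x y → (x ℤ.+ y) ℤ.+ (ℤ.- y) ≡ x
        cancel = solve-∀
        r∈I : (+ ℕ.suc (toℕ (fromℕ< r<d′))) ∈ I
        r∈I = ≡.subst I
          (≡.trans (≡.cong (λ x → x ℤ.- a /ℕ d ℤ.* + d) eq)
            (≡.trans (cancel (+ ℕ.suc r) (a /ℕ d ℤ.* + d)) (≡.cong (λ n → + ℕ.suc n) (≡.sym (toℕ-fromℕ< r<d′)))))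
          (+-closed a∈I (neg-closed (multiple-closed (a /ℕ d) d∈I)))

-- Cosets of sublattices of finite index

infixl 6 _⊕_ _⊖_

_⊕_ _⊖_ : ∀ {k} → Vector ℤ k → Vector ℤ k → Vector ℤ k
(u ⊕ v) i = u i ℤ.+ v i
(u ⊖ v) i = u i ℤ.- v i

0ᵥ : ∀ {k} → Vector ℤ k
0ᵥ _ = 0ℤ

-- Membership is decidable because coset representatives are found by search; `respects` stands in
-- for function extensionality, vectors being functions.
record Sublattice (k : ℕ) : Set₁ where
  field
    member     : Pred (Vector ℤ k) 0ℓ
    member?    : U.Decidable member
    respects   : ∀ {u v} → u ≗ v → u ∈ member → v ∈ member
    +-closed   : ∀ {u v} → u ∈ member → v ∈ member → (u ⊕ v) ∈ member
    neg-closed : ∀ {u} → u ∈ member → (ℤ.-_ ∘ u) ∈ member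

record Transversal {k} (H : Sublattice k) (s : ℕ) : Set where
  open Sublattice H
  field
    rep      : Fin s → Vector ℤ k
    covers   : ∀ v → ∃ λ j → (v ⊖ rep j) ∈ member
    distinct : ∀ {i j} → (rep i ⊖ rep j) ∈ member → i ≡ j

∷-cong : ∀ {k} {a b : ℤ} {u v : Vector ℤ k} → a ≡ b → u ≗ v → (a ∷ u) ≗ (b ∷ v)
∷-cong a≡b u≗v zero    = a≡b
∷-cong a≡b u≗v (suc i) = u≗v i

-- ℤ^{1+k} / H is an extension of ℤ^k / H′, with H′ the projection of H, by
-- the cyclic group ℤ / {a ∣ (a , 0) ∈ H}.

transversal : ∀ d .{{_ : NonZero d}} {k} (H : Sublattice k) →
              (∀ (v : Vector ℤ k) → (λ i → + d ℤ.* v i) ∈ Sublattice.member H) →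
              ∃ λ s → Transversal H s × s ℕ∣.∣ d ℕ.^ k
transversal d {ℕ.zero} H d∈H = 1 , record
  { rep      = λ _ ()
  ; covers   = λ v → zero , Sublattice.respects H (λ ()) (d∈H v)
  ; distinct = λ { {zero} {zero} _ → ≡.refl }
  } , ℕ∣.∣-refl
transversal d {ℕ.suc k} H d∈H = m ℕ.* r , T , ℕ∣.*-pres-∣ m∣d r∣dᵏ
  where
  open Sublattice H

  projection : Pred (Vector ℤ k) 0ℓ
  projection v = ∃ λ a → (a ∷ v) ∈ member

  -- Multiples of d in the first coordinate lie in `H`, so that coordinate matters only modulo d;
  -- membership in the projection becomes a search over d values.
  reduce : ∀ {a v} → (a ∷ v) ∈ member → (+ (a %ℕ d) ∷ v) ∈ member
  reduce {a} {v} av∈H =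
    respects (λ { zero → head≡ ; (suc i) → tail≡ (v i) }) (+-closed av∈H (d∈H (ℤ.- (a /ℕ d) ∷ 0ᵥ)))
    where
    regroup : ∀ r q e → (r ℤ.+ q ℤ.* e) ℤ.+ e ℤ.* (ℤ.- q) ≡ r
    regroup = solve-∀
    head≡ : a ℤ.+ + d ℤ.* (ℤ.- (a /ℕ d)) ≡ + (a %ℕ d)
    head≡ = ≡.trans (≡.cong (λ y → y ℤ.+ + d ℤ.* (ℤ.- (a /ℕ d))) (a≡a%ℕn+[a/ℕn]*n a d)) (regroup (+ (a %ℕ d)) (a /ℕ d) (+ d))
    tail≡ : ∀ x → x ℤ.+ + d ℤ.* 0ℤ ≡ x
    tail≡ x = ≡.trans (≡.cong (λ y → x ℤ.+ y) (ℤ.*-zeroʳ (+ d))) (ℤ.+-identityʳ x)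

  H′ : Sublattice k
  H′ = record
    { member     = projection
    ; member?    = λ v → map′
        (λ (i , p) → + toℕ i , p)
        (λ (a , p) → fromℕ< (n%ℕd<d a d) ,
          respects (∷-cong (≡.cong +_ (≡.sym (toℕ-fromℕ< _))) (λ _ → ≡.refl)) (reduce p))
        (any? (λ (i : Fin d) → member? (+ toℕ i ∷ v)))
    ; respects   = λ u≗v (a , p) → a , respects (∷-cong ≡.refl u≗v) p
    ; +-closed   = λ (a , p) (b , q) → a ℤ.+ b ,
        respects (λ { zero → ≡.refl ; (suc _) → ≡.refl }) (+-closed p q)
    ; neg-closed = λ (a , p) → ℤ.- a ,
        respects (λ { zero → ≡.refl ; (suc _) → ≡.refl }) (neg-closed p)
    }

  I : Pred ℤ 0ℓ
  I a = (a ∷ 0ᵥ) ∈ member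

  I-+ : ∀ {a b} → a ∈ I → b ∈ I → (a ℤ.+ b) ∈ I
  I-+ p q = respects (λ { zero → ≡.refl ; (suc _) → ≡.refl }) (+-closed p q)

  I-neg : ∀ {a} → a ∈ I → (ℤ.- a) ∈ I
  I-neg p = respects (λ { zero → ≡.refl ; (suc _) → ≡.refl }) (neg-closed p)

  d∈I : (+ d) ∈ I
  d∈I = respects (λ { zero → ℤ.*-identityʳ (+ d) ; (suc i) → ℤ.*-zeroʳ (+ d) }) (d∈H (1ℤ ∷ 0ᵥ))

  I-principal : ∃ λ m → NonZero m × (∀ {a} → a ∈ I → (+ m) ℤ∣.∣ a) × (+ m) ∈ I
  I-principal = ideal-principal
    I-+ I-neg
    (λ a → member? (a ∷ 0ᵥ))
    d (ℕ.>-nonZero (ℕ.>-nonZero⁻¹ d)) d∈I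

  m = proj₁ I-principal
  instance
    m≢0 : NonZero m
    m≢0 = proj₁ (proj₂ I-principal)
  I⇒m∣ = proj₁ (proj₂ (proj₂ I-principal))

  multiples∈I : ∀ q → (q ℤ.* + m) ∈ I
  multiples∈I q = multiple-closed {I = I}
    I-+ I-neg
    q (proj₂ (proj₂ (proj₂ I-principal)))

  m∣d : m ℕ∣.∣ d
  m∣d = ℤ∣.∣⇒∣ᵤ (I⇒m∣ d∈I)

  recursive : ∃ λ s → Transversal H′ s × s ℕ∣.∣ d ℕ.^ k
  recursive = transversal d H′ (λ v → 0ℤ ,
    respects (λ { zero → ℤ.*-zeroʳ (+ d) ; (suc i) → ≡.refl }) (d∈H (0ℤ ∷ v)))

  r = proj₁ recursive
  r∣dᵏ = proj₂ (proj₂ recursive)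
  module T′ = Transversal (proj₁ (proj₂ recursive))

  rep₂ : Fin m × Fin r → Vector ℤ (ℕ.suc k)
  rep₂ (i , j) = + toℕ i ∷ T′.rep j

  distinct₂ : ∀ p q → (rep₂ p ⊖ rep₂ q) ∈ member → p ≡ q
  distinct₂ (i , j) (i′ , j′) h with T′.distinct
    (+ toℕ i ℤ.- + toℕ i′ , respects (λ { zero → ≡.refl ; (suc _) → ≡.refl }) h)
  -- Equal second components cancel, which leaves in `I` a difference of two residues below m, hence
  -- a multiple of m.
  ... | ≡.refl = ≡.cong (_, j) (toℕ-injective (residue≡ (toℕ<n i) (toℕ<n i′)
      (I⇒m∣ (respects (λ { zero → ≡.refl ; (suc l) → ℤ.+-inverseʳ (T′.rep j l) }) h))))
    where
    residue≡ : ∀ {a b} → a ℕ.< m → b ℕ.< m → (+ m) ℤ∣.∣ (+ a ℤ.- + b) → a ≡ b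
    residue≡ {a} {b} a<m b<m m∣a-b = ℤ.+-injective (ℤ.i-j≡0⇒i≡j (+ a) (+ b)
      (ℤ.∣i∣≡0⇒i≡0 (vanishes ∣a-b∣<m (ℤ∣.∣⇒∣ᵤ m∣a-b))))
      where
      ∣a-b∣<m : ℤ.∣ + a ℤ.- + b ∣ ℕ.< m
      ∣a-b∣<m = ℕ.≤-<-trans
        (≡.subst (λ x → ℤ.∣ x ∣ ℕ.≤ a ℕ.⊔ b) (≡.sym (ℤ.m-n≡m⊖n a b)) (ℤ.∣m⊝n∣≤m⊔n a b))
        (ℕ.⊔-pres-<m a<m b<m)
      vanishes : ∀ {x} → x ℕ.< m → m ℕ∣.∣ x → x ≡ 0
      vanishes {ℕ.zero}  _   _   = ≡.refl
      vanishes {ℕ.suc _} x<m m∣x = contradiction x<m (ℕ.≤⇒≯ (ℕ∣.∣⇒≤ m∣x))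

  covers₂ : ∀ v → ∃ λ p → (v ⊖ rep₂ p) ∈ member
  covers₂ v with T′.covers (v ∘ suc)
  -- The member of `H` with tail `(v ∘ suc) ⊖ T′.rep j` has first coordinate b; removing it leaves
  -- only `v zero - b` to be reduced modulo m.
  ... | j , b , p = (fromℕ< (n%ℕd<d a m) , j) ,
        respects (λ { zero → head≡ ; (suc l) → ℤ.+-identityʳ _ }) (+-closed p (multiples∈I (a /ℕ m)))
    where
    a = v zero ℤ.- b
    regroup : ∀ v b r x → (v ℤ.- b) ≡ r ℤ.+ x → b ℤ.+ x ≡ v ℤ.- r
    regroup v b r x eq = ≡.trans (lemma₁ b r x) (≡.trans (≡.cong (λ z → b ℤ.- r ℤ.+ z) (≡.sym eq)) (lemma₂ v b r))
      where
      lemma₁ : ∀ b r x → b ℤ.+ x ≡ b ℤ.- r ℤ.+ (r ℤ.+ x)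
      lemma₁ = solve-∀
      lemma₂ : ∀ v b r → b ℤ.- r ℤ.+ (v ℤ.- b) ≡ v ℤ.- r
      lemma₂ = solve-∀
    head≡ : b ℤ.+ (a /ℕ m) ℤ.* + m ≡ v zero ℤ.- + toℕ (fromℕ< (n%ℕd<d a m))
    head≡ = regroup (v zero) b _ _ (≡.trans (a≡a%ℕn+[a/ℕn]*n a m)
      (≡.cong (λ x → + x ℤ.+ (a /ℕ m) ℤ.* + m) (≡.sym (toℕ-fromℕ< _))))

  T : Transversal H (m ℕ.* r)
  T = record
    { rep      = rep₂ ∘ remQuot {m} r
    ; covers   = λ v → let (i , j) , p = covers₂ v in
        combine i j , ≡.subst (λ z → (v ⊖ rep₂ z) ∈ member) (≡.sym (remQuot-combine i j)) p
    ; distinct = λ {x} {y} h → ≡.trans (≡.sym (combine-remQuot {m} r x))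
        (≡.trans (≡.cong (λ (i , j) → combine i j) (distinct₂ (remQuot {m} r x) (remQuot {m} r y) h))
                 (combine-remQuot {m} r y))
    }

-- Torsion of the cokernel of an integer matrix

module _ {a ℓ} (S : Setoid a ℓ) where
  open Setoid S

  enumerated⇒HasOrder : ∀ {s} (to : Fin s → Carrier) →
                        (∀ {i j} → to i ≈ to j → i ≡ j) → (∀ x → ∃ λ j → to j ≈ x) → HasOrder S s
  enumerated⇒HasOrder to inj surj = record
    { to        = to
    ; from      = λ x → proj₁ (surj x)
    ; to-cong   = λ { ≡.refl → refl }
    ; from-cong = λ {x} {y} x≈y →
        inj (trans (proj₂ (surj x)) (trans x≈y (sym (proj₂ (surj y)))))
    ; inverse   = (λ { {x} ≡.refl → proj₂ (surj x) })
                , (λ {i} {x} x≈i → inj (trans (proj₂ (surj x)) x≈i))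
    }

∑-neg : ∀ {N} (x : Vector ℤ N) → ∑ℤ (ℤ.-_ ∘ x) ≡ ℤ.- ∑ℤ x
∑-neg {ℕ.zero}  x = ≡.refl
∑-neg {ℕ.suc N} x = ≡.trans (≡.cong (λ s → ℤ.- x zero ℤ.+ s) (∑-neg (x ∘ suc)))
                            (≡.sym (ℤ.neg-distrib-+ (x zero) _))

∑-⊖ : ∀ {N} (x y : Vector ℤ N) → ∑ℤ (x ⊖ y) ≡ ∑ℤ x ℤ.- ∑ℤ y
∑-⊖ x y = ≡.trans (ℤSum.∑-distrib-+ x (ℤ.-_ ∘ y)) (≡.cong (λ s → ∑ℤ x ℤ.+ s) (∑-neg y))

module _ {N} (A : Matrix N) where

  open IsGroupHomomorphism (⊛-isGroupHomomorphism A) public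
    using () renaming (⟦⟧-cong to ⊛-cong; homo to ⊛-⊕; ⁻¹-homo to ⊛-neg; ε-homo to ⊛-0)

  ⊛-⊖ : ∀ x y → (A ⊛ (x ⊖ y)) ≗ (A ⊛ x) ⊖ (A ⊛ y)
  ⊛-⊖ x y i = ≡.trans (⊛-⊕ x (ℤ.-_ ∘ y) i) (≡.cong (λ s → (A ⊛ x) i ℤ.+ s) (⊛-neg y i))

  ⊛-scale : ∀ c x i → (A ⊛ (λ j → c ℤ.* x j)) i ≡ c ℤ.* (A ⊛ x) i
  ⊛-scale c x i = ≡.trans
    (ℤSum.sum-cong-≗ (λ j → swap (A i j) c (x j)))
    (≡.sym (ℤSum.*-distribˡ-sum c (λ j → A i j ℤ.* x j)))
    where
    swap : ∀ a c x → a ℤ.* (c ℤ.* x) ≡ c ℤ.* (a ℤ.* x)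
    swap = solve-∀

  ⊛-assoc : ∀ (B : Matrix N) x → ((A ⊗ B) ⊛ x) ≗ (A ⊛ (B ⊛ x))
  ⊛-assoc B x i = begin
    ∑ℤ (λ j → ∑ℤ (λ k → A i k ℤ.* B k j) ℤ.* x j)
      ≡⟨ ℤSum.sum-cong-≗ (λ j → ℤSum.*-distribʳ-sum (x j) (λ k → A i k ℤ.* B k j)) ⟩
    ∑ℤ (λ j → ∑ℤ (λ k → A i k ℤ.* B k j ℤ.* x j))
      ≡⟨ ℤSum.∑-comm (λ j k → A i k ℤ.* B k j ℤ.* x j) ⟩
    ∑ℤ (λ k → ∑ℤ (λ j → A i k ℤ.* B k j ℤ.* x j))
      ≡⟨ ℤSum.sum-cong-≗ (λ k → ≡.trans
           (ℤSum.sum-cong-≗ (λ j → ℤ.*-assoc (A i k) (B k j) (x j)))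
           (≡.sym (ℤSum.*-distribˡ-sum (A i k) (λ j → B k j ℤ.* x j)))) ⟩
    ∑ℤ (λ k → A i k ℤ.* ∑ℤ (λ j → B k j ℤ.* x j)) ∎

  ⊛-congᴹ : ∀ {B : Matrix N} → A ≋ B → ∀ x → (A ⊛ x) ≗ (B ⊛ x)
  ⊛-congᴹ A≋B x i = ℤSum.sum-cong-≗ (λ j → ≡.cong (ℤ._* x j) (A≋B i j))

diagonal-∑ : ∀ {N} (d x : Vector ℤ N) i → ∑ℤ (λ j → diagonal d i j ℤ.* x j) ≡ d i ℤ.* x i
diagonal-∑ {ℕ.suc N} d x zero = ≡.trans
  (≡.cong (λ s → d zero ℤ.* x zero ℤ.+ s)
    (ℤSum.sum-replicate-zero N))
  (ℤ.+-identityʳ _)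
diagonal-∑ {ℕ.suc N} d x (suc i) = ≡.trans (ℤ.+-identityˡ _)
  (diagonal-∑ (d ∘ suc) (x ∘ suc) i)

identity-⊛ : ∀ {N} (x : Vector ℤ N) → (identity ⊛ x) ≗ x
identity-⊛ x i = ≡.trans (diagonal-∑ (λ _ → 1ℤ) x i) (ℤ.*-identityˡ (x i))

identity-sym : ∀ {N} (i j : Fin N) → identity i j ≡ identity j i
identity-sym i j = ≡.cong (if_then 1ℤ else 0ℤ) (does-⇔ (mk⇔ ≡.sym ≡.sym) (i ≟ j) (j ≟ i))

⊛-column : ∀ {N} (A : Matrix N) j i → (A ⊛ (λ k → identity k j)) i ≡ A i j
⊛-column A j i = ≡.trans
  (ℤSum.sum-cong-≗ (λ k → ≡.trans (ℤ.*-comm (A i k) (identity k j))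
                                  (≡.cong (ℤ._* A i k) (identity-sym k j))))
  (identity-⊛ (A i) j)

module Torsion {N} (L : Matrix N) (d : ℕ) .{{d≢0 : NonZero d}}
  (L-sum : ∀ x → ∑ℤ (L ⊛ x) ≡ 0ℤ)
  (annihilated : ∀ x → ∑ℤ x ≡ 0ℤ → ∃ λ z → (λ i → + d ℤ.* x i) ≗ (L ⊛ z)) where

  Image : Pred (Vector ℤ N) 0ℓ
  Image y = ∃ λ z → y ≗ (L ⊛ z)

  -- Summation kills the image of `L`, and ℤ has no zero divisors. The multiple n serves both for
  -- the order of a torsion class and for an invariant factor.
  multiple-image⇒∑≡0 : ∀ n .{{_ : ℤ.NonZero n}} {y} → Image (λ i → n ℤ.* y i) → ∑ℤ y ≡ 0ℤ
  multiple-image⇒∑≡0 n {y} (z , ny≗Lz) = ℤ.*-cancelˡ-≡ n _ _ (begin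
    n ℤ.* ∑ℤ y               ≡⟨ ℤSum.*-distribˡ-sum n y ⟩
    ∑ℤ (λ i → n ℤ.* y i)     ≡⟨ ℤSum.sum-cong-≗ ny≗Lz ⟩
    ∑ℤ (L ⊛ z)               ≡⟨ L-sum z ⟩
    0ℤ                       ≡⟨ ℤ.*-zeroʳ n ⟨
    n ℤ.* 0ℤ                 ∎)

  -- Testing preimages modulo d is enough: if y agrees modulo d with the image of a residue vector,
  -- the difference is d times a vector w, which again has sum zero, so `annihilated` supplies a
  -- preimage of it.
  image? : ∀ y → ∑ℤ y ≡ 0ℤ → Dec (Image y)
  image? y ∑y≡0 = map′ sound complete
    (any? (λ x → all? (λ i → + d ℤ∣.∣? y i ℤ.- (L ⊛ residues x) i)))
    where
    residues : Fin (d ℕ.^ N) → Vector ℤ N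
    residues x = +_ ∘ toℕ ∘ finToFun x

    sound : (∃ λ x → ∀ i → (+ d) ℤ∣.∣ (y i ℤ.- (L ⊛ residues x) i)) → Image y
    sound (x , d∣) = residues x ⊕ z , λ i → begin
      y i                                               ≡⟨ split (y i) ((L ⊛ residues x) i) ⟩
      (L ⊛ residues x) i ℤ.+ (y i ℤ.- (L ⊛ residues x) i)
        ≡⟨ ≡.cong (λ s → (L ⊛ residues x) i ℤ.+ s) (≡.trans (w-eq i) (dw≗Lz i)) ⟩
      (L ⊛ residues x) i ℤ.+ (L ⊛ z) i                  ≡⟨ ⊛-⊕ L (residues x) z i ⟨
      (L ⊛ (residues x ⊕ z)) i                          ∎
      where
      split : ∀ a b → a ≡ b ℤ.+ (a ℤ.- b)
      split = solve-∀
      w : Vector ℤ N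
      w i = ℤ∣._∣_.quotient (d∣ i)
      w-eq : ∀ i → y i ℤ.- (L ⊛ residues x) i ≡ + d ℤ.* w i
      w-eq i = ≡.trans (ℤ∣._∣_.equality (d∣ i)) (ℤ.*-comm (w i) (+ d))
      ∑w≡0 : ∑ℤ w ≡ 0ℤ
      ∑w≡0 = ℤ.*-cancelˡ-≡ (+ d) _ _ (begin
        + d ℤ.* ∑ℤ w                      ≡⟨ ℤSum.*-distribˡ-sum (+ d) w ⟩
        ∑ℤ (λ i → + d ℤ.* w i)            ≡⟨ ℤSum.sum-cong-≗ w-eq ⟨
        ∑ℤ (y ⊖ (L ⊛ residues x))         ≡⟨ ∑-⊖ y (L ⊛ residues x) ⟩
        ∑ℤ y ℤ.- ∑ℤ (L ⊛ residues x)      ≡⟨ ≡.cong₂ ℤ._-_ ∑y≡0 (L-sum (residues x)) ⟩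
        0ℤ                                ≡⟨ ℤ.*-zeroʳ (+ d) ⟨
        + d ℤ.* 0ℤ                        ∎)
      z = proj₁ (annihilated w ∑w≡0)
      dw≗Lz = proj₂ (annihilated w ∑w≡0)

    complete : Image y → ∃ λ x → ∀ i → (+ d) ℤ∣.∣ (y i ℤ.- (L ⊛ residues x) i)
    complete (z , y≗Lz) = x , λ i → divides ((L ⊛ q) i) (begin
      y i ℤ.- (L ⊛ residues x) i            ≡⟨ ≡.cong (ℤ._- (L ⊛ residues x) i) (y≗Lz i) ⟩
      (L ⊛ z) i ℤ.- (L ⊛ residues x) i      ≡⟨ ⊛-⊖ L z (residues x) i ⟨
      (L ⊛ (z ⊖ residues x)) i              ≡⟨ ⊛-cong L difference i ⟩
      (L ⊛ (λ j → + d ℤ.* q j)) i           ≡⟨ ⊛-scale L (+ d) q i ⟩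
      + d ℤ.* (L ⊛ q) i                     ≡⟨ ℤ.*-comm (+ d) _ ⟩
      (L ⊛ q) i ℤ.* + d                     ∎)
      where
      residue : Fin N → Fin d
      residue j = fromℕ< (n%ℕd<d (z j) d)
      x : Fin (d ℕ.^ N)
      x = funToFin residue
      q : Vector ℤ N
      q j = z j /ℕ d
      cancel : ∀ a b c → a ℤ.+ b ℤ.* c ℤ.- a ≡ c ℤ.* b
      cancel = solve-∀
      difference : (z ⊖ residues x) ≗ (λ j → + d ℤ.* q j)
      difference j = begin
        z j ℤ.- + toℕ (finToFun x j)
          ≡⟨ ≡.cong₂ (λ a i → a ℤ.- + toℕ i) (a≡a%ℕn+[a/ℕn]*n (z j) d) (finToFun-funToFin residue j) ⟩
        + (z j %ℕ d) ℤ.+ q j ℤ.* + d ℤ.- + toℕ (residue j)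
          ≡⟨ ≡.cong (λ r → + (z j %ℕ d) ℤ.+ q j ℤ.* + d ℤ.- + r) (toℕ-fromℕ< (n%ℕd<d (z j) d)) ⟩
        + (z j %ℕ d) ℤ.+ q j ℤ.* + d ℤ.- + (z j %ℕ d)
          ≡⟨ cancel (+ (z j %ℕ d)) (q j) (+ d) ⟩
        + d ℤ.* q j ∎

  private
    module C = AbelianGroup (cokernel (ℤ^ N) (⊛-isGroupHomomorphism L))
  open Mult C.commutativeMonoid using () renaming (_×_ to _·_)

  ·-multiple : ∀ n (y : Vector ℤ N) i → (n · y) i ≡ + n ℤ.* y i
  ·-multiple ℕ.zero    y i = ≡.refl
  ·-multiple (ℕ.suc n) y i = ≡.trans (≡.cong (λ s → y i ℤ.+ s) (·-multiple n y i))
                                     (≡.sym (ℤ.suc-* (+ n) (y i)))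

  ∑≡0⇒torsion : ∀ {y} → ∑ℤ y ≡ 0ℤ → Torsion (cokernel (ℤ^ N) (⊛-isGroupHomomorphism L)) y
  ∑≡0⇒torsion {y} ∑y≡0 =
    let z , dy≗Lz = annihilated y ∑y≡0
    in d , ℕ.>-nonZero (ℕ.>-nonZero⁻¹ d) , z , λ i →
         ≡.trans (ℤ.+-identityʳ _) (≡.trans (·-multiple d y i) (dy≗Lz i))

  torsion⇒∑≡0 : ∀ {y} → Torsion (cokernel (ℤ^ N) (⊛-isGroupHomomorphism L)) y → ∑ℤ y ≡ 0ℤ
  torsion⇒∑≡0 {y} (n , n≢0 , z , eq) = multiple-image⇒∑≡0 (+ n) {{n≢0}} (z , λ i →
    ≡.trans (≡.sym (·-multiple n y i)) (≡.trans (≡.sym (ℤ.+-identityʳ _)) (eq i)))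

  -- With P L Q = D, the column y of P⁻¹ at the given index satisfies dᵢ y = L Q eᵢ, so y has sum
  -- zero. Then d y = L z for some z, and applying P gives d = dᵢ (Q⁻¹ z)ᵢ. Hence every nonzero
  -- invariant factor divides d.
  elementaryDivisor-trivial : ∀ {p} → Prime p → ¬ (p ℕ∣.∣ d) → ∀ e → ElementaryDivisor L p e → e ≡ 0
  elementaryDivisor-trivial _ _ ℕ.zero _ = ≡.refl
  elementaryDivisor-trivial {p} _ p∤d (ℕ.suc e) E = contradiction
    (ℕ∣.∣-trans (ℕ∣.∣-trans (ℕ∣.m∣m*n (p ℕ.^ e)) E.divides) dᵢ∣d) p∤d
    where
    module E = ElementaryDivisor E
    open SmithForm E.smith hiding (divides)
    i₀ = E.index
    dᵢ = invariant i₀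
    P⁻¹ = proj₁ P-unimodular
    Q⁻¹ = proj₁ Q-unimodular
    y eᵢ : Vector ℤ N
    y  i = P⁻¹ i i₀
    eᵢ i = identity i i₀
    D = diagonal (+_ ∘ invariant)

    LQeᵢ≗dᵢy : (L ⊛ (Q ⊛ eᵢ)) ≗ (λ i → + dᵢ ℤ.* y i)
    LQeᵢ≗dᵢy i = begin
      (L ⊛ (Q ⊛ eᵢ)) i                          ≡⟨ identity-⊛ (L ⊛ (Q ⊛ eᵢ)) i ⟨
      (identity ⊛ (L ⊛ (Q ⊛ eᵢ))) i             ≡⟨ ⊛-congᴹ (P⁻¹ ⊗ P) (proj₂ (proj₂ P-unimodular)) (L ⊛ (Q ⊛ eᵢ)) i ⟨
      ((P⁻¹ ⊗ P) ⊛ (L ⊛ (Q ⊛ eᵢ))) i            ≡⟨ ⊛-assoc P⁻¹ P (L ⊛ (Q ⊛ eᵢ)) i ⟩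
      (P⁻¹ ⊛ (P ⊛ (L ⊛ (Q ⊛ eᵢ)))) i            ≡⟨ ⊛-cong P⁻¹ PLQ i ⟩
      (P⁻¹ ⊛ (λ k → + dᵢ ℤ.* eᵢ k)) i           ≡⟨ ⊛-scale P⁻¹ (+ dᵢ) eᵢ i ⟩
      + dᵢ ℤ.* (P⁻¹ ⊛ eᵢ) i                     ≡⟨ ≡.cong (λ s → + dᵢ ℤ.* s) (⊛-column P⁻¹ i₀ i) ⟩
      + dᵢ ℤ.* y i                              ∎
      where
      diag-column : ∀ k → + invariant k ℤ.* eᵢ k ≡ + dᵢ ℤ.* eᵢ k
      diag-column k with k ≟ i₀
      ... | yes ≡.refl = ≡.refl
      ... | no  _      = ≡.trans (ℤ.*-zeroʳ (+ invariant k)) (≡.sym (ℤ.*-zeroʳ (+ dᵢ)))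
      PLQ : (P ⊛ (L ⊛ (Q ⊛ eᵢ))) ≗ (λ k → + dᵢ ℤ.* eᵢ k)
      PLQ k = begin
        (P ⊛ (L ⊛ (Q ⊛ eᵢ))) k      ≡⟨ ⊛-assoc P L (Q ⊛ eᵢ) k ⟨
        ((P ⊗ L) ⊛ (Q ⊛ eᵢ)) k      ≡⟨ ⊛-assoc (P ⊗ L) Q eᵢ k ⟨
        ((P ⊗ L ⊗ Q) ⊛ eᵢ) k        ≡⟨ ⊛-congᴹ (P ⊗ L ⊗ Q) isDiagonal eᵢ k ⟩
        (D ⊛ eᵢ) k                  ≡⟨ diagonal-∑ (+_ ∘ invariant) eᵢ k ⟩
        + invariant k ℤ.* eᵢ k      ≡⟨ diag-column k ⟩
        + dᵢ ℤ.* eᵢ k               ∎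

    ∑y≡0 : ∑ℤ y ≡ 0ℤ
    ∑y≡0 = multiple-image⇒∑≡0 (+ dᵢ) {{ℕ.≢-nonZero E.nonzero}} (Q ⊛ eᵢ , λ i → ≡.sym (LQeᵢ≗dᵢy i))
    z = proj₁ (annihilated y ∑y≡0)
    dy≗Lz = proj₂ (annihilated y ∑y≡0)

    dᵢ∣d : dᵢ ℕ∣.∣ d
    dᵢ∣d = ℤ∣.∣⇒∣ᵤ (divides {+ dᵢ} {+ d} ((Q⁻¹ ⊛ z) i₀) (begin
      + d                                   ≡⟨ ℤ.*-identityʳ (+ d) ⟨
      + d ℤ.* 1ℤ                            ≡⟨ ≡.cong (λ b → + d ℤ.* (if b then 1ℤ else 0ℤ)) (dec-true (i₀ ≟ i₀) ≡.refl) ⟨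
      -- `(P ⊛ y) i₀` is by definition the diagonal entry of `P ⊗ P⁻¹` at `i₀`.
      + d ℤ.* eᵢ i₀                         ≡⟨ ≡.cong (λ s → + d ℤ.* s) (proj₁ (proj₂ P-unimodular) i₀ i₀) ⟨
      + d ℤ.* (P ⊛ y) i₀                    ≡⟨ ⊛-scale P (+ d) y i₀ ⟨
      (P ⊛ (λ i → + d ℤ.* y i)) i₀          ≡⟨ ⊛-cong P dy≗Lz i₀ ⟩
      (P ⊛ (L ⊛ z)) i₀
        ≡⟨ ⊛-cong P (⊛-cong L (λ i → ≡.trans
             (⊛-congᴹ (Q ⊗ Q⁻¹) (proj₁ (proj₂ Q-unimodular)) z i) (identity-⊛ z i))) i₀ ⟨
      (P ⊛ (L ⊛ ((Q ⊗ Q⁻¹) ⊛ z))) i₀        ≡⟨ ⊛-cong P (⊛-cong L (⊛-assoc Q Q⁻¹ z)) i₀ ⟩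
      (P ⊛ (L ⊛ (Q ⊛ (Q⁻¹ ⊛ z)))) i₀        ≡⟨ ⊛-assoc P L (Q ⊛ (Q⁻¹ ⊛ z)) i₀ ⟨
      ((P ⊗ L) ⊛ (Q ⊛ (Q⁻¹ ⊛ z))) i₀        ≡⟨ ⊛-assoc (P ⊗ L) Q (Q⁻¹ ⊛ z) i₀ ⟨
      ((P ⊗ L ⊗ Q) ⊛ (Q⁻¹ ⊛ z)) i₀          ≡⟨ ⊛-congᴹ (P ⊗ L ⊗ Q) isDiagonal (Q⁻¹ ⊛ z) i₀ ⟩
      (D ⊛ (Q⁻¹ ⊛ z)) i₀                    ≡⟨ diagonal-∑ (+_ ∘ invariant) (Q⁻¹ ⊛ z) i₀ ⟩
      + dᵢ ℤ.* (Q⁻¹ ⊛ z) i₀                 ≡⟨ ℤ.*-comm (+ dᵢ) _ ⟩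
      (Q⁻¹ ⊛ z) i₀ ℤ.* + dᵢ                 ∎))

-- The order of the critical group

prime∣^⇒∣ : ∀ {p d} → Prime p → ∀ e → p ℕ∣.∣ d ℕ.^ e → p ℕ∣.∣ d
prime∣^⇒∣ pr ℕ.zero    p∣1 = contradiction (ℕ∣.∣1⇒≡1 p∣1) (ℕ.nonTrivial⇒≢1 {{prime⇒nonTrivial pr}})
prime∣^⇒∣ {d = d} pr (ℕ.suc e) p∣ = [ (λ p∣d → p∣d) , prime∣^⇒∣ pr e ]′ (euclidsLemma d (d ℕ.^ e) pr p∣)

-- A zero-sum vector is determined by its coordinates after the first, so the
-- torsion subgroup is ℤ^k / H with H the preimage of the image of L.

criticalGroup-order : ∀ {N} (L : Matrix N) (d : ℕ) .{{d≢0 : NonZero d}} →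
  (∀ x → ∑ℤ (L ⊛ x) ≡ 0ℤ) →
  (∀ x → ∑ℤ x ≡ 0ℤ → ∃ λ z → (λ i → + d ℤ.* x i) ≗ (L ⊛ z)) →
  ∃ λ s → HasOrder (AbelianGroup.setoid (criticalGroup L)) s × s ℕ∣.∣ d ℕ.^ ℕ.pred N
criticalGroup-order {ℕ.zero} L d L-sum annihilated =
  1 , enumerated⇒HasOrder (AbelianGroup.setoid (criticalGroup L)) {1}
        (λ _ → (λ ()) , ∑≡0⇒torsion ≡.refl)
        (λ { {zero} {zero} _ → ≡.refl })
        (λ _ → zero , (λ ()) , λ ())
    , ℕ∣.∣-refl
  where open Torsion L d L-sum annihilated
criticalGroup-order {ℕ.suc k} L d L-sum annihilated =
  let s , T , s∣dᵏ = transversal d H d∈H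
      open Transversal T
  in s , enumerated⇒HasOrder (AbelianGroup.setoid (criticalGroup L))
           (λ j → lift (rep j) , ∑≡0⇒torsion (∑-lift (rep j)))
           (λ {i} {j} (z , eq) → distinct (z , λ l → ≡.trans (lift-⊖ (rep i) (rep j) l) (eq l)))
           (λ (y , y-torsion) → let j , z , eq = covers (y ∘ suc) in
             j , AbelianGroup.sym (cokernel (ℤ^ (ℕ.suc k)) (⊛-isGroupHomomorphism L)) {y} {lift (rep j)} (z , λ i →
               ≡.trans (≡.cong (ℤ._- lift (rep j) i) (zero-sum≗lift {y} (torsion⇒∑≡0 y-torsion) i))
                       (≡.trans (≡.sym (lift-⊖ (y ∘ suc) (rep j) i)) (eq i))))
       , s∣dᵏ
  where
  open Torsion L d L-sum annihilated

  lift : Vector ℤ k → Vector ℤ (ℕ.suc k)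
  lift v = ℤ.- ∑ℤ v ∷ v

  ∑-lift : ∀ v → ∑ℤ (lift v) ≡ 0ℤ
  ∑-lift v = ℤ.+-inverseˡ (∑ℤ v)

  zero-sum≗lift : ∀ {y} → ∑ℤ y ≡ 0ℤ → y ≗ lift (y ∘ suc)
  zero-sum≗lift {y} ∑y≡0 zero    = begin
    y zero                               ≡⟨ split (y zero) (∑ℤ (y ∘ suc)) ⟩
    ∑ℤ y ℤ.- ∑ℤ (y ∘ suc)                ≡⟨ ≡.cong (ℤ._- ∑ℤ (y ∘ suc)) ∑y≡0 ⟩
    0ℤ ℤ.- ∑ℤ (y ∘ suc)                  ≡⟨ ℤ.+-identityˡ _ ⟩
    ℤ.- ∑ℤ (y ∘ suc)                     ∎
    where
    split : ∀ a b → a ≡ a ℤ.+ b ℤ.- b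
    split = solve-∀
  zero-sum≗lift        ∑y≡0 (suc i) = ≡.refl

  lift-cong : ∀ {u v} → u ≗ v → lift u ≗ lift v
  lift-cong u≗v = ∷-cong (≡.cong ℤ.-_ (ℤSum.sum-cong-≗ u≗v)) u≗v

  lift-⊕ : ∀ u v → lift (u ⊕ v) ≗ lift u ⊕ lift v
  lift-⊕ u v zero    = ≡.trans (≡.cong ℤ.-_ (ℤSum.∑-distrib-+ u v)) (ℤ.neg-distrib-+ (∑ℤ u) (∑ℤ v))
  lift-⊕ u v (suc i) = ≡.refl

  lift-neg : ∀ u → lift (ℤ.-_ ∘ u) ≗ ℤ.-_ ∘ lift u
  lift-neg u zero    = ≡.cong ℤ.-_ (∑-neg u)
  lift-neg u (suc i) = ≡.refl

  lift-⊖ : ∀ u v → lift (u ⊖ v) ≗ lift u ⊖ lift v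
  lift-⊖ u v i = ≡.trans (lift-⊕ u (ℤ.-_ ∘ v) i) (≡.cong (λ s → lift u i ℤ.+ s) (lift-neg v i))

  H : Sublattice k
  H = record
    { member     = λ v → Image (lift v)
    ; member?    = λ v → image? (lift v) (∑-lift v)
    ; respects   = λ u≗v (z , eq) → z , λ i → ≡.trans (≡.sym (lift-cong u≗v i)) (eq i)
    ; +-closed   = λ {u} {v} (z , eq) (z′ , eq′) → z ⊕ z′ , λ i → ≡.trans (lift-⊕ u v i)
        (≡.trans (≡.cong₂ ℤ._+_ (eq i) (eq′ i)) (≡.sym (⊛-⊕ L z z′ i)))
    ; neg-closed = λ {u} (z , eq) → ℤ.-_ ∘ z , λ i → ≡.trans (lift-neg u i)
        (≡.trans (≡.cong ℤ.-_ (eq i)) (≡.sym (⊛-neg L z i)))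
    }

  lift-scale : ∀ c v → lift (λ i → c ℤ.* v i) ≗ (λ i → c ℤ.* lift v i)
  lift-scale c v zero    = ≡.trans (≡.cong ℤ.-_ (≡.sym (ℤSum.*-distribˡ-sum c v))) (ℤ.neg-distribʳ-* c (∑ℤ v))
  lift-scale c v (suc i) = ≡.refl

  d∈H : ∀ v → Image (lift (λ i → + d ℤ.* v i))
  d∈H v = let z , eq = annihilated (lift v) (∑-lift v)
          in z , λ i → ≡.trans (lift-scale (+ d) v i) (eq i)

-- The annihilator arises as an expression in ℤ, whereas the order is compared with a natural
-- number; passing to the absolute value costs at most a sign of z. It is nonzero because p divides
-- 0.
no-p-torsion : ∀ {N} (L : Matrix N) (D : ℤ) {p} → Prime p → ¬ (p ℕ∣.∣ ℤ.∣ D ∣) →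
  (∀ x → ∑ℤ (L ⊛ x) ≡ 0ℤ) →
  (∀ x → ∑ℤ x ≡ 0ℤ → ∃ λ z → (λ i → D ℤ.* x i) ≗ (L ⊛ z)) →
  (∀ e → ElementaryDivisor L p e → e ≡ 0) ×
  (∃ λ s → HasOrder (AbelianGroup.setoid (criticalGroup L)) s × ¬ (p ℕ∣.∣ s))
no-p-torsion {N} L D {p} pr p∤D L-sum annihilated =
  let s , s-order , s∣dⁿ = criticalGroup-order L ℤ.∣ D ∣ L-sum annihilated′
  in Torsion.elementaryDivisor-trivial L ℤ.∣ D ∣ L-sum annihilated′ pr p∤D
   , s , s-order , λ p∣s → p∤D (prime∣^⇒∣ pr (ℕ.pred N) (ℕ∣.∣-trans p∣s s∣dⁿ))
  where
  instance
    D≢0 : NonZero ℤ.∣ D ∣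
    D≢0 = ℕ.≢-nonZero λ D≡0 → p∤D (≡.subst (p ℕ∣.∣_) (≡.sym D≡0) (p ℕ∣.∣0))
  annihilated′ : ∀ x → ∑ℤ x ≡ 0ℤ → ∃ λ z → (λ i → + ℤ.∣ D ∣ ℤ.* x i) ≗ (L ⊛ z)
  annihilated′ x ∑x≡0 with z , eq ← annihilated x ∑x≡0 = absolute D eq
    where
    absolute : ∀ D → (λ i → D ℤ.* x i) ≗ (L ⊛ z) → ∃ λ z → (λ i → + ℤ.∣ D ∣ ℤ.* x i) ≗ (L ⊛ z)
    absolute (+ _)    eq = z , eq
    absolute -[1+ n ] eq = ℤ.-_ ∘ z , λ i → begin
      + ℕ.suc n ℤ.* x i               ≡⟨ ℤ.neg-involutive _ ⟨
      ℤ.- (ℤ.- (+ ℕ.suc n ℤ.* x i))   ≡⟨ ≡.cong ℤ.-_ (ℤ.neg-distribˡ-* (+ ℕ.suc n) (x i)) ⟩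
      ℤ.- (-[1+ n ] ℤ.* x i)          ≡⟨ ≡.cong ℤ.-_ (eq i) ⟩
      ℤ.- (L ⊛ z) i                   ≡⟨ ⊛-neg L z i ⟨
      (L ⊛ (ℤ.-_ ∘ z)) i              ∎

-- Laplacians of regular graphs

-- The exchange of summation behind every double count below: f weighs vectors, g weighs lines and h
-- is their incidence.
∑-∑-linear : ∀ {m n} (f : Vector ℤ m) (g : Vector ℤ n) (h : Fin m → Fin n → ℤ) →
             ∑ℤ (λ j → g j ℤ.* ∑ℤ (λ i → f i ℤ.* h i j)) ≡ ∑ℤ (λ i → f i ℤ.* ∑ℤ (λ j → g j ℤ.* h i j))
∑-∑-linear f g h = begin
  ∑ℤ (λ j → g j ℤ.* ∑ℤ (λ i → f i ℤ.* h i j))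
    ≡⟨ ℤSum.sum-cong-≗ (λ j → ℤSum.*-distribˡ-sum (g j) (λ i → f i ℤ.* h i j)) ⟩
  ∑ℤ (λ j → ∑ℤ (λ i → g j ℤ.* (f i ℤ.* h i j)))
    ≡⟨ ℤSum.∑-comm (λ j i → g j ℤ.* (f i ℤ.* h i j)) ⟩
  ∑ℤ (λ i → ∑ℤ (λ j → g j ℤ.* (f i ℤ.* h i j)))
    ≡⟨ ℤSum.sum-cong-≗ (λ i → ≡.trans
         (ℤSum.sum-cong-≗ (λ j → swap (g j) (f i) (h i j)))
         (≡.sym (ℤSum.*-distribˡ-sum (f i) (λ j → g j ℤ.* h i j)))) ⟩
  ∑ℤ (λ i → f i ℤ.* ∑ℤ (λ j → g j ℤ.* h i j)) ∎
  where
  swap : ∀ a b c → a ℤ.* (b ℤ.* c) ≡ b ℤ.* (a ℤ.* c)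
  swap = solve-∀

∑-affine : ∀ {n} (f h : Vector ℤ n) a b →
           ∑ℤ (λ i → f i ℤ.* (a ℤ.+ b ℤ.* h i)) ≡ ∑ℤ f ℤ.* a ℤ.+ b ℤ.* ∑ℤ (λ i → f i ℤ.* h i)
∑-affine f h a b = begin
  ∑ℤ (λ i → f i ℤ.* (a ℤ.+ b ℤ.* h i))
    ≡⟨ ℤSum.sum-cong-≗ (λ i → expand (f i) (h i) a b) ⟩
  ∑ℤ (λ i → f i ℤ.* a ℤ.+ b ℤ.* (f i ℤ.* h i))
    ≡⟨ ℤSum.∑-distrib-+ (λ i → f i ℤ.* a) (λ i → b ℤ.* (f i ℤ.* h i)) ⟩
  ∑ℤ (λ i → f i ℤ.* a) ℤ.+ ∑ℤ (λ i → b ℤ.* (f i ℤ.* h i))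
    ≡⟨ ≡.cong₂ ℤ._+_ (ℤSum.*-distribʳ-sum a f) (ℤSum.*-distribˡ-sum b (λ i → f i ℤ.* h i)) ⟨
  ∑ℤ f ℤ.* a ℤ.+ b ℤ.* ∑ℤ (λ i → f i ℤ.* h i) ∎
  where
  expand : ∀ f h a b → f ℤ.* (a ℤ.+ b ℤ.* h) ≡ f ℤ.* a ℤ.+ b ℤ.* (f ℤ.* h)
  expand = solve-∀

∑-ones : ∀ n → ∑ℤ {n} (λ _ → 1ℤ) ≡ + n
∑-ones ℕ.zero    = ≡.refl
∑-ones (ℕ.suc n) = ≡.cong (λ s → 1ℤ ℤ.+ s) (∑-ones n)

module RegularLaplacian {N} (A : Matrix N) (k : ℕ) (Q M : ℤ)
  (A-sym : ∀ i j → A i j ≡ A j i) (A-sum : ∀ i → ∑ℤ (A i) ≡ + k) where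

  -- C i j is the number of nonzero vectors common to the lines i and j, and
  -- Q = q, M = q ^ (n - 2).

  C L : Matrix N
  C i j = (Q ℤ.* Q ℤ.- 1ℤ) ℤ.* identity i j ℤ.+ (Q ℤ.- 1ℤ) ℤ.* A i j
  L i j = + k ℤ.* identity i j ℤ.- A i j

  -- `s` and `r` count the nonzero vectors of a line and of a one-dimensional subspace.
  s r f g : ℤ
  s = Q ℤ.* Q ℤ.- 1ℤ
  r = Q ℤ.- 1ℤ
  f = s ℤ.+ r ℤ.* + k
  g = Q ℤ.* M ℤ.- Q

  C-sym : ∀ i j → C i j ≡ C j i
  C-sym i j = ≡.cong₂ (λ e a → s ℤ.* e ℤ.+ r ℤ.* a) (identity-sym i j) (A-sym i j)

  C-⊛ : ∀ x i → (C ⊛ x) i ≡ s ℤ.* x i ℤ.+ r ℤ.* (A ⊛ x) i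
  C-⊛ x i = begin
    ∑ℤ (λ j → (s ℤ.* identity i j ℤ.+ r ℤ.* A i j) ℤ.* x j)
      ≡⟨ ℤSum.sum-cong-≗ (λ j → expand s (identity i j) r (A i j) (x j)) ⟩
    ∑ℤ (λ j → s ℤ.* (identity i j ℤ.* x j) ℤ.+ r ℤ.* (A i j ℤ.* x j))
      ≡⟨ ℤSum.∑-distrib-+ (λ j → s ℤ.* (identity i j ℤ.* x j)) (λ j → r ℤ.* (A i j ℤ.* x j)) ⟩
    ∑ℤ (λ j → s ℤ.* (identity i j ℤ.* x j)) ℤ.+ ∑ℤ (λ j → r ℤ.* (A i j ℤ.* x j))
      ≡⟨ ≡.cong₂ ℤ._+_ (ℤSum.*-distribˡ-sum s (λ j → identity i j ℤ.* x j)) (ℤSum.*-distribˡ-sum r (λ j → A i j ℤ.* x j)) ⟨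
    s ℤ.* (identity ⊛ x) i ℤ.+ r ℤ.* (A ⊛ x) i
      ≡⟨ ≡.cong (λ y → s ℤ.* y ℤ.+ r ℤ.* (A ⊛ x) i) (identity-⊛ x i) ⟩
    s ℤ.* x i ℤ.+ r ℤ.* (A ⊛ x) i ∎
    where
    expand : ∀ s e r a x → (s ℤ.* e ℤ.+ r ℤ.* a) ℤ.* x ≡ s ℤ.* (e ℤ.* x) ℤ.+ r ℤ.* (a ℤ.* x)
    expand = solve-∀

  L-⊛ : ∀ x i → (L ⊛ x) i ≡ + k ℤ.* x i ℤ.- (A ⊛ x) i
  L-⊛ x i = begin
    ∑ℤ (λ j → (+ k ℤ.* identity i j ℤ.- A i j) ℤ.* x j)
      ≡⟨ ℤSum.sum-cong-≗ (λ j → expand (+ k) (identity i j) (A i j) (x j)) ⟩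
    ∑ℤ ((λ j → + k ℤ.* (identity i j ℤ.* x j)) ⊖ (λ j → A i j ℤ.* x j))
      ≡⟨ ∑-⊖ (λ j → + k ℤ.* (identity i j ℤ.* x j)) (λ j → A i j ℤ.* x j) ⟩
    ∑ℤ (λ j → + k ℤ.* (identity i j ℤ.* x j)) ℤ.- (A ⊛ x) i
      ≡⟨ ≡.cong (ℤ._- (A ⊛ x) i) (≡.trans (≡.cong (λ y → + k ℤ.* y) (≡.sym (identity-⊛ x i)))
           (ℤSum.*-distribˡ-sum (+ k) (λ j → identity i j ℤ.* x j))) ⟨
    + k ℤ.* x i ℤ.- (A ⊛ x) i ∎
    where
    expand : ∀ k e a x → (k ℤ.* e ℤ.- a) ℤ.* x ≡ k ℤ.* (e ℤ.* x) ℤ.- a ℤ.* x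
    expand = solve-∀

  ∑-A⊛ : ∀ x → ∑ℤ (A ⊛ x) ≡ + k ℤ.* ∑ℤ x
  ∑-A⊛ x = begin
    ∑ℤ (λ i → ∑ℤ (λ j → A i j ℤ.* x j))   ≡⟨ ℤSum.∑-comm (λ i j → A i j ℤ.* x j) ⟩
    ∑ℤ (λ j → ∑ℤ (λ i → A i j ℤ.* x j))   ≡⟨ ℤSum.sum-cong-≗ (λ j → begin
        ∑ℤ (λ i → A i j ℤ.* x j)          ≡⟨ ℤSum.*-distribʳ-sum (x j) (λ i → A i j) ⟨
        ∑ℤ (λ i → A i j) ℤ.* x j          ≡⟨ ≡.cong (ℤ._* x j) (ℤSum.sum-cong-≗ (λ i → A-sym i j)) ⟩
        ∑ℤ (A j) ℤ.* x j                  ≡⟨ ≡.cong (ℤ._* x j) (A-sum j) ⟩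
        + k ℤ.* x j                       ∎) ⟩
    ∑ℤ (λ j → + k ℤ.* x j)                ≡⟨ ℤSum.*-distribˡ-sum (+ k) x ⟨
    + k ℤ.* ∑ℤ x                          ∎

  L-sum : ∀ x → ∑ℤ (L ⊛ x) ≡ 0ℤ
  L-sum x = begin
    ∑ℤ (L ⊛ x)                                  ≡⟨ ℤSum.sum-cong-≗ (L-⊛ x) ⟩
    ∑ℤ ((λ i → + k ℤ.* x i) ⊖ (A ⊛ x))          ≡⟨ ∑-⊖ (λ i → + k ℤ.* x i) (A ⊛ x) ⟩
    ∑ℤ (λ i → + k ℤ.* x i) ℤ.- ∑ℤ (A ⊛ x)       ≡⟨ ≡.cong₂ ℤ._-_ (≡.sym (ℤSum.*-distribˡ-sum (+ k) x)) (∑-A⊛ x) ⟩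
    + k ℤ.* ∑ℤ x ℤ.- + k ℤ.* ∑ℤ x               ≡⟨ ℤ.+-inverseʳ (+ k ℤ.* ∑ℤ x) ⟩
    0ℤ                                          ∎

  C-sum : ∀ i → ∑ℤ (C i) ≡ f
  C-sum i = begin
    ∑ℤ (C i)                        ≡⟨ ℤSum.sum-cong-≗ (λ j → ℤ.*-identityʳ (C i j)) ⟨
    (C ⊛ (λ _ → 1ℤ)) i              ≡⟨ C-⊛ (λ _ → 1ℤ) i ⟩
    s ℤ.* 1ℤ ℤ.+ r ℤ.* (A ⊛ (λ _ → 1ℤ)) i
      ≡⟨ ≡.cong₂ (λ a b → a ℤ.+ r ℤ.* b) (ℤ.*-identityʳ s)
           (≡.trans (ℤSum.sum-cong-≗ (λ j → ℤ.*-identityʳ (A i j))) (A-sum i)) ⟩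
    f                               ∎

  module _ (C² : ∀ i l → ∑ℤ (λ j → C i j ℤ.* C l j) ≡ s ℤ.* s ℤ.+ g ℤ.* C i l) where

    -- `C²` pairs rows with rows, as a double count delivers it; symmetry turns this into a matrix
    -- square, whose constant part `s * s` a zero-sum vector annihilates.
    C-C⊛ : ∀ x → ∑ℤ x ≡ 0ℤ → ∀ i → (C ⊛ (C ⊛ x)) i ≡ g ℤ.* (C ⊛ x) i
    C-C⊛ x ∑x≡0 i = begin
      (C ⊛ (C ⊛ x)) i                                  ≡⟨ ⊛-assoc C C x i ⟨
      ∑ℤ (λ l → ∑ℤ (λ j → C i j ℤ.* C j l) ℤ.* x l)
        ≡⟨ ℤSum.sum-cong-≗ (λ l → ≡.trans (ℤ.*-comm _ (x l)) (≡.cong (λ y → x l ℤ.* y)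
             (≡.trans (ℤSum.sum-cong-≗ (λ j → ≡.cong (λ y → C i j ℤ.* y) (C-sym j l))) (C² i l)))) ⟩
      ∑ℤ (λ l → x l ℤ.* (s ℤ.* s ℤ.+ g ℤ.* C i l))     ≡⟨ ∑-affine x (C i) (s ℤ.* s) g ⟩
      ∑ℤ x ℤ.* (s ℤ.* s) ℤ.+ g ℤ.* ∑ℤ (λ l → x l ℤ.* C i l)
        ≡⟨ ≡.cong₂ (λ a b → a ℤ.* (s ℤ.* s) ℤ.+ g ℤ.* b) ∑x≡0
             (ℤSum.sum-cong-≗ (λ l → ℤ.*-comm (x l) (C i l))) ⟩
      0ℤ ℤ.* (s ℤ.* s) ℤ.+ g ℤ.* (C ⊛ x) i             ≡⟨ ℤ.+-identityˡ _ ⟩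
      g ℤ.* (C ⊛ x) i                                  ∎

    -- On zero-sum vectors C² = g C and (q - 1) L = f - C, whence
    -- (q - 1) L ((f - g) + C) = f (f - g).

    annihilated : ∀ x → ∑ℤ x ≡ 0ℤ → ∃ λ z → (λ i → f ℤ.* (f ℤ.- g) ℤ.* x i) ≗ (L ⊛ z)
    annihilated x ∑x≡0 = (λ i → r ℤ.* y i) , λ i → begin
      f ℤ.* (f ℤ.- g) ℤ.* x i                              ≡⟨ factor s r (+ k) g (x i) ((C ⊛ x) i) ⟩
      f ℤ.* y i ℤ.- ((f ℤ.- g) ℤ.* (C ⊛ x) i ℤ.+ g ℤ.* (C ⊛ x) i)
                                                           ≡⟨ ≡.cong (λ c → f ℤ.* y i ℤ.- c) (Cy i) ⟨
      f ℤ.* y i ℤ.- (C ⊛ y) i                              ≡⟨ ≡.cong (λ c → f ℤ.* y i ℤ.- c) (C-⊛ y i) ⟩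
      f ℤ.* y i ℤ.- (s ℤ.* y i ℤ.+ r ℤ.* (A ⊛ y) i)        ≡⟨ regroup s r (+ k) (y i) ((A ⊛ y) i) ⟩
      r ℤ.* (+ k ℤ.* y i ℤ.- (A ⊛ y) i)                    ≡⟨ ≡.cong (λ c → r ℤ.* c) (L-⊛ y i) ⟨
      r ℤ.* (L ⊛ y) i                                      ≡⟨ ⊛-scale L r y i ⟨
      (L ⊛ (λ j → r ℤ.* y j)) i                            ∎
      where
      y : Vector ℤ N
      y i = (f ℤ.- g) ℤ.* x i ℤ.+ (C ⊛ x) i
      factor : ∀ s r k g x c → (s ℤ.+ r ℤ.* k) ℤ.* ((s ℤ.+ r ℤ.* k) ℤ.- g) ℤ.* x
        ≡ (s ℤ.+ r ℤ.* k) ℤ.* (((s ℤ.+ r ℤ.* k) ℤ.- g) ℤ.* x ℤ.+ c) ℤ.- (((s ℤ.+ r ℤ.* k) ℤ.- g) ℤ.* c ℤ.+ g ℤ.* c)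
      factor = solve-∀
      regroup : ∀ s r k y a → (s ℤ.+ r ℤ.* k) ℤ.* y ℤ.- (s ℤ.* y ℤ.+ r ℤ.* a) ≡ r ℤ.* (k ℤ.* y ℤ.- a)
      regroup = solve-∀
      Cy : ∀ i → (C ⊛ y) i ≡ (f ℤ.- g) ℤ.* (C ⊛ x) i ℤ.+ g ℤ.* (C ⊛ x) i
      Cy i = ≡.trans (⊛-⊕ C (λ j → (f ℤ.- g) ℤ.* x j) (C ⊛ x) i)
        (≡.cong₂ ℤ._+_ (⊛-scale C (f ℤ.- g) x i) (C-C⊛ x ∑x≡0 i))

  -- Modulo q, r f ≡ 1 and g ≡ 0.

  f-unit : ∀ {p} → Prime p → (+ p) ℤ∣.∣ Q → r ℤ.* f ≡ s ℤ.* (Q ℤ.* M ℤ.- 1ℤ) →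
           ¬ (p ℕ∣.∣ ℤ.∣ f ℤ.* (f ℤ.- g) ∣)
  f-unit {p} pr p∣Q rf p∣D = p∤f ([ ∣ₛ , f-g ]′ (euclidsLemma ℤ.∣ f ∣ ℤ.∣ f ℤ.- g ∣ pr
      (≡.subst (p ℕ∣.∣_) (ℤ.∣i*j∣≡∣i∣*∣j∣ f (f ℤ.- g)) p∣D)))
    where
    ∣ₛ : ∀ {a} → p ℕ∣.∣ ℤ.∣ a ∣ → (+ p) ℤ∣.∣ a
    ∣ₛ = ℤ∣.∣ᵤ⇒∣
    p∣g : (+ p) ℤ∣.∣ g
    p∣g = ℤ∣.∣m∣n⇒∣m-n (ℤ∣.∣m⇒∣m*n M p∣Q) p∣Q
    f-g : p ℕ∣.∣ ℤ.∣ f ℤ.- g ∣ → (+ p) ℤ∣.∣ f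
    f-g p∣f-g = ≡.subst ((+ p) ℤ∣.∣_) (restore f g) (ℤ∣.∣m∣n⇒∣m+n (∣ₛ {f ℤ.- g} p∣f-g) p∣g)
      where
      restore : ∀ a b → a ℤ.- b ℤ.+ b ≡ a
      restore = solve-∀
    p∤f : ¬ ((+ p) ℤ∣.∣ f)
    p∤f p∣f = ℕ.nonTrivial⇒≢1 {{prime⇒nonTrivial pr}} (ℕ∣.∣1⇒≡1 (ℤ∣.∣⇒∣ᵤ p∣1))
      where
      -- The row sum is controlled through `r * f`, and this product differs from 1 by an explicit
      -- multiple of Q.
      remainder : ∀ Q M → (Q ℤ.* Q ℤ.- 1ℤ) ℤ.* (Q ℤ.* M ℤ.- 1ℤ) ℤ.- Q ℤ.* (Q ℤ.* (Q ℤ.* M) ℤ.- Q ℤ.- M) ≡ 1ℤ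
      remainder = solve-∀
      p∣1 : (+ p) ℤ∣.∣ 1ℤ
      p∣1 = ≡.subst ((+ p) ℤ∣.∣_) (remainder Q M)
        (ℤ∣.∣m∣n⇒∣m-n (≡.subst ((+ p) ℤ∣.∣_) rf (ℤ∣.∣n⇒∣m*n r p∣f))
                      (ℤ∣.∣m⇒∣m*n (Q ℤ.* (Q ℤ.* M) ℤ.- Q ℤ.- M) p∣Q))

regularLaplacian-no-p-torsion : ∀ {N} (A : Matrix N) (k : ℕ) (Q M : ℤ) {p} → Prime p → (+ p) ℤ∣.∣ Q →
  (A-sym : ∀ i j → A i j ≡ A j i) (A-sum : ∀ i → ∑ℤ (A i) ≡ + k) →
  let open RegularLaplacian A k Q M A-sym A-sum in
  (∀ i l → ∑ℤ (λ j → C i j ℤ.* C l j) ≡ s ℤ.* s ℤ.+ g ℤ.* C i l) →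
  (∀ i → r ℤ.* ∑ℤ (C i) ≡ s ℤ.* (Q ℤ.* M ℤ.- 1ℤ)) →
  (∀ e → ElementaryDivisor L p e → e ≡ 0) ×
  (∃ λ n → HasOrder (AbelianGroup.setoid (criticalGroup L)) n × ¬ (p ℕ∣.∣ n))
-- The value of `f` is read off from a row, so the matrix without rows is treated apart, with 1 as
-- annihilator.
regularLaplacian-no-p-torsion {ℕ.zero} A k Q M {p} pr p∣Q A-sym A-sum C² rC =
  no-p-torsion L 1ℤ pr (λ p∣1 → ℕ.nonTrivial⇒≢1 {{prime⇒nonTrivial pr}} (ℕ∣.∣1⇒≡1 p∣1)) L-sum
    (λ x _ → x , λ ())
  where open RegularLaplacian A k Q M A-sym A-sum
regularLaplacian-no-p-torsion {ℕ.suc _} A k Q M pr p∣Q A-sym A-sum C² rC =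
  no-p-torsion L (f ℤ.* (f ℤ.- g)) pr
    (f-unit pr p∣Q (≡.trans (≡.cong (λ c → r ℤ.* c) (≡.sym (C-sum zero))) (rC zero)))
    L-sum (annihilated C²)
  where open RegularLaplacian A k Q M A-sym A-sum

-- Counting with indicator functions

private
  variable
    a b : Level
    P : Set a
    R : Set b

-- Entries of `identity` and `adjacencyMatrix` are by definition values of `𝟙`, so the counting
-- lemmas apply to them directly.
𝟙 : Dec P → ℤ
𝟙 d = if does d then 1ℤ else 0ℤ

𝟙-yes : (d : Dec P) → P → 𝟙 d ≡ 1ℤ
𝟙-yes d p = ≡.cong (if_then 1ℤ else 0ℤ) (dec-true d p)

𝟙-no : (d : Dec P) → ¬ P → 𝟙 d ≡ 0ℤ
𝟙-no d ¬p = ≡.cong (if_then 1ℤ else 0ℤ) (dec-false d ¬p)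

𝟙-⇔ : (d : Dec P) (e : Dec R) → (P → R) → (R → P) → 𝟙 d ≡ 𝟙 e
𝟙-⇔ d e f g = ≡.cong (if_then 1ℤ else 0ℤ) (does-⇔ (mk⇔ f g) d e)

𝟙-× : (d : Dec P) (e : Dec R) → 𝟙 d ℤ.* 𝟙 e ≡ 𝟙 (d ×-dec e)
𝟙-× (yes _) (yes _) = ≡.refl
𝟙-× (yes _) (no _)  = ≡.refl
𝟙-× (no _)  _       = ≡.refl

𝟙-¬ : (d : Dec P) → 𝟙 (¬? d) ≡ 1ℤ ℤ.- 𝟙 d
𝟙-¬ (yes _) = ≡.refl
𝟙-¬ (no _)  = ≡.refl

-- Lets an identity valid only under a condition be used in a sum weighted by the indicator of that
-- condition.
𝟙-*-congˡ : (d : Dec P) {x y : ℤ} → (P → x ≡ y) → 𝟙 d ℤ.* x ≡ 𝟙 d ℤ.* y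
𝟙-*-congˡ (yes p) f = ≡.cong (1ℤ ℤ.*_) (f p)
𝟙-*-congˡ (no _)  f = ≡.refl

module _ {n} {P : Pred (Fin n) a} (P? : U.Decidable P) where

  ∑-unique : ∀ i → P i → (∀ {j} → P j → i ≡ j) → ∑ℤ (𝟙 ∘ P?) ≡ 1ℤ
  ∑-unique i pi unique = begin
    ∑ℤ (𝟙 ∘ P?)                    ≡⟨ ℤSum.sum-cong-≗ (λ j →
        ≡.trans (𝟙-⇔ (P? j) (i ≟ j) unique (λ { ≡.refl → pi })) (≡.sym (ℤ.*-identityʳ (identity i j)))) ⟩
    (identity ⊛ (λ _ → 1ℤ)) i      ≡⟨ identity-⊛ (λ _ → 1ℤ) i ⟩
    1ℤ                             ∎

  ∑-none : (∀ i → ¬ P i) → ∑ℤ (𝟙 ∘ P?) ≡ 0ℤ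
  ∑-none ¬p = ≡.trans (ℤSum.sum-cong-≗ (λ i → 𝟙-no (P? i) (¬p i))) (ℤSum.sum-replicate-zero n)

∑-filter : ∀ {A : Set a} {P : Pred A b} (P? : U.Decidable P) {n} (f : Fin n → A) →
           ∑ℤ (𝟙 ∘ P? ∘ f) ≡ + length (filter P? (tabulate f))
∑-filter P? {ℕ.zero}  f = ≡.refl
∑-filter P? {ℕ.suc n} f with does (P? (f zero))
... | true  = ≡.cong (λ s → 1ℤ ℤ.+ s) (∑-filter P? (f ∘ suc))
... | false = ≡.trans (ℤ.+-identityˡ _) (∑-filter P? (f ∘ suc))

∑≡0⇒none : ∀ {n} {P : Pred (Fin n) a} (P? : U.Decidable P) → ∑ℤ (𝟙 ∘ P?) ≡ 0ℤ → ∀ i → ¬ P i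
∑≡0⇒none {n = ℕ.suc n} P? ∑≡0 i pi with P? zero
-- Rewriting the rest of the sum as a list length shows it to be nonnegative, so the leading 1
-- cannot be cancelled.
... | yes p = contradiction (≡.trans (≡.sym (≡.cong (λ s → 1ℤ ℤ.+ s) (∑-filter (P? ∘ suc) (λ j → j)))) ∑≡0) λ ()
∑≡0⇒none {n = ℕ.suc n} P? ∑≡0 zero    pi | no ¬p = ¬p pi
∑≡0⇒none {n = ℕ.suc n} P? ∑≡0 (suc i) pi | no ¬p =
  ∑≡0⇒none (P? ∘ suc) (≡.trans (≡.sym (ℤ.+-identityˡ _)) ∑≡0) i pi

module _ {n} {P : Pred (Fin n) a} {Q : Pred (Fin n) b} (P? : U.Decidable P) (Q? : U.Decidable Q)
         (P⊆Q : P ⊆ Q) where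

  ∑-difference : ∑ℤ (λ i → 𝟙 (Q? i ×-dec ¬? (P? i))) ≡ ∑ℤ (𝟙 ∘ Q?) ℤ.- ∑ℤ (𝟙 ∘ P?)
  ∑-difference = ≡.trans
    (ℤSum.sum-cong-≗ pointwise)
    (∑-⊖ (𝟙 ∘ Q?) (𝟙 ∘ P?))
    where
    pointwise : ∀ i → 𝟙 (Q? i ×-dec ¬? (P? i)) ≡ 𝟙 (Q? i) ℤ.- 𝟙 (P? i)
    pointwise i with Q? i | P? i
    ... | yes _ | yes _ = ≡.refl
    ... | yes _ | no  _ = ≡.refl
    ... | no ¬q | yes p = contradiction (P⊆Q p) ¬q
    ... | no _  | no  _ = ≡.refl

  -- The indicator of the members of `Q` outside `P` sums to zero. For subspaces this plays the part
  -- of a comparison of dimensions.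
  equinumerous⇒⊇ : ∑ℤ (𝟙 ∘ P?) ≡ ∑ℤ (𝟙 ∘ Q?) → Q ⊆ P
  equinumerous⇒⊇ eq {i} qi = decidable-stable (P? i) λ ¬pi →
    ∑≡0⇒none (λ i → Q? i ×-dec ¬? (P? i))
      (≡.trans ∑-difference (ℤ.i≡j⇒i-j≡0 (≡.sym eq))) i (qi , ¬pi)

funToFin-cong : ∀ {m n} {f g : Fin m → Fin n} → f ≗ g → funToFin f ≡ funToFin g
funToFin-cong {ℕ.zero}  f≗g = ≡.refl
funToFin-cong {ℕ.suc m} f≗g = ≡.cong₂ combine (f≗g zero) (funToFin-cong (f≗g ∘ suc))

module _ {c ℓ} (S : Setoid c ℓ) (S-finite : Finite S) where
  open Setoid S
  open Inverse (proj₂ S-finite) using (to; from; from-cong; strictlyInverseˡ; strictlyInverseʳ)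

  to-injective : ∀ {i j} → to i ≈ to j → i ≡ j
  to-injective {i} {j} eq =
    ≡.trans (≡.sym (strictlyInverseʳ i)) (≡.trans (from-cong eq) (strictlyInverseʳ j))

  tuple-injective : ∀ {k} {i j : Fin (proj₁ S-finite ℕ.^ k)} →
                    (∀ l → tuple S S-finite {k} i l ≈ tuple S S-finite {k} j l) → i ≡ j
  tuple-injective {k} {i} {j} eq = ≡.trans (≡.sym (funToFin-finToFin {k} i))
    (≡.trans (funToFin-cong {k} (λ l → to-injective (eq l))) (funToFin-finToFin {k} j))

  -- Count the pairs of i and j with `to i ≈ g j`: an i satisfying `P` occurs with one j, any other
  -- i with none, and each j with exactly one i.
  ∑-enumerated : ∀ {p} {P : Pred Carrier p} (P? : U.Decidable P) → P Respects _≈_ →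
    ∀ {r} (g : Fin r → Carrier) → (∀ j → P (g j)) → (∀ {i j} → g i ≈ g j → i ≡ j) →
    (∀ {x} → P x → ∃ λ j → x ≈ g j) → ∑ℤ (λ i → 𝟙 (P? (to i))) ≡ + r
  ∑-enumerated P? resp {r} g g∈P inj surj = begin
    ∑ℤ (λ i → 𝟙 (P? (to i)))
      ≡⟨ ℤSum.sum-cong-≗ hits ⟩
    ∑ℤ (λ i → ∑ℤ (λ j → 𝟙 (to i ≟ₛ g j)))
      ≡⟨ ℤSum.∑-comm (λ i j → 𝟙 (to i ≟ₛ g j)) ⟩
    ∑ℤ (λ j → ∑ℤ (λ i → 𝟙 (to i ≟ₛ g j)))
      ≡⟨ ℤSum.sum-cong-≗ (λ j → ∑-unique (λ i → to i ≟ₛ g j) (from (g j)) (strictlyInverseˡ (g j))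
           (λ {i} toi≈ → to-injective (trans (strictlyInverseˡ (g j)) (sym toi≈)))) ⟩
    ∑ℤ {r} (λ _ → 1ℤ)
      ≡⟨ ∑-ones r ⟩
    + r ∎
    where
    _≟ₛ_ = finite-≟ S S-finite
    hits : ∀ i → 𝟙 (P? (to i)) ≡ ∑ℤ (λ j → 𝟙 (to i ≟ₛ g j))
    hits i with P? (to i)
    ... | yes p = let j , eq = surj p in
      ≡.sym (∑-unique (λ j → to i ≟ₛ g j) j eq (λ eq′ → inj (trans (sym eq) eq′)))
    ... | no ¬p = ≡.sym (∑-none (λ j → to i ≟ₛ g j) (λ j eq → ¬p (resp (sym eq) (g∈P j))))

-- Lines of a finite vector space

module Grassmann {c ℓ₁ ℓ₂ m ℓm} (F : HeytingField c ℓ₁ ℓ₂) (V : VectorSpace F m ℓm)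
  {q : ℕ} (F-order : HasOrder (CommutativeRing.setoid (fieldRing F)) q)
  {n : ℕ} (V-dim : LinearAlgebra.HasDimension F V (U.U {A = Module.Carrierᴹ V}) n) where

  open LinearAlgebra F V
  open Module V
  private
    module F = HeytingField F
    module FR = CommutativeRing (fieldRing F)
    module HP = HeytingProperties (HeytingField.heytingCommutativeRing F)
    module VP = AbelianGroupProperties +ᴹ-abelianGroup

  F-finite : Finite FR.setoid
  F-finite = q , F-order

  Line : Set _
  Line = Setoid.Carrier (Grassmannian 2)

  _≟0 : ∀ x → Dec (x ≈ᴹ 0ᴹ)
  x ≟0 = vectors-≟ F-finite V-dim x 0ᴹ

  _∈ₗ?_ : ∀ x (W : Line) → Dec (member (proj₁ W) x)
  x ∈ₗ? W = ∈? F-finite V-dim W x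

  ⟨_⟩ : Carrierᴹ → Subspace
  ⟨ x ⟩ = span {1} (λ _ → x)

  _∈⟨_⟩? : ∀ y x → Dec (member ⟨ x ⟩ y)
  y ∈⟨ x ⟩? = ∈-span? F-finite V-dim {1} (λ _ → x) y

  ⟨⟩⇒multiple : ∀ {x y} → y ∈ member ⟨ x ⟩ → ∃ λ α → y ≈ᴹ α *ₗ x
  ⟨⟩⇒multiple (α , eq) = α zero , ≈ᴹ-trans eq (+ᴹ-identityʳ _)

  multiple⇒⟨⟩ : ∀ {x y} α → y ≈ᴹ α *ₗ x → y ∈ member ⟨ x ⟩
  multiple⇒⟨⟩ α eq = (λ _ → α) , ≈ᴹ-trans eq (≈ᴹ-sym (+ᴹ-identityʳ _))

  ⟨⟩⊆ : ∀ (W : Subspace) {x} → x ∈ member W → member ⟨ x ⟩ ⊆ member W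
  ⟨⟩⊆ W x∈W y∈ = let α , eq = ⟨⟩⇒multiple y∈
    in Subspace.≈-closed W (≈ᴹ-sym eq) (Subspace.*-closed W α x∈W)

  -- Apartness from 0 makes `α - 0` invertible, and this difference is then identified with α.
  unscale : ∀ {α x} → α F.# F.0# → ∃ λ β → β *ₗ (α *ₗ x) ≈ᴹ x
  unscale {α} {x} α#0 = let β , βα≈1 , _ = F.#⇒invertible α#0 in
    β , ≈ᴹ-trans (≈ᴹ-sym (*ₗ-assoc β α x))
          (≈ᴹ-trans (*ₗ-cong (F.trans (F.*-congˡ (F.sym (HP.x-0≈x α))) βα≈1) ≈ᴹ-refl) (*ₗ-identityˡ x))

  -- By tightness it is enough to refute that α is apart from 0, and such an α could be scaled away.
  scale≈0⇒α≈0 : ∀ {α x} → x ≉ᴹ 0ᴹ → α *ₗ x ≈ᴹ 0ᴹ → α F.≈ F.0#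
  scale≈0⇒α≈0 {α} {x} x≉0 αx≈0 = proj₁ (F.tight α F.0#) λ α#0 →
    let β , βαx≈x = unscale α#0
    in x≉0 (≈ᴹ-trans (≈ᴹ-sym βαx≈x) (≈ᴹ-trans (*ₗ-cong F.refl αx≈0) (*ₗ-zeroʳ β)))

  independent₁ : ∀ {x} → x ≉ᴹ 0ᴹ → LinearlyIndependent {1} (λ _ → x)
  independent₁ x≉0 α eq zero = scale≈0⇒α≈0 x≉0 (≈ᴹ-trans (≈ᴹ-sym (+ᴹ-identityʳ _)) eq)

  pair : Carrierᴹ → Carrierᴹ → Vector Carrierᴹ 2
  pair x y = x ∷ λ _ → y

  -- If the coefficient of y were apart from 0, y could be solved for as a multiple of x; so it
  -- vanishes, and `x ≉ᴹ 0ᴹ` then removes the other one.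
  independent₂ : ∀ {x y} → x ≉ᴹ 0ᴹ → y ∉ member ⟨ x ⟩ → LinearlyIndependent (pair x y)
  independent₂ {x} {y} x≉0 y∉⟨x⟩ α eq = λ { zero → α≈0 ; (suc zero) → β≈0 }
    where
    αx+βy≈0 : α zero *ₗ x +ᴹ α (suc zero) *ₗ y ≈ᴹ 0ᴹ
    αx+βy≈0 = ≈ᴹ-trans (+ᴹ-congˡ (≈ᴹ-sym (+ᴹ-identityʳ _))) eq
    β≈0 : α (suc zero) F.≈ F.0#
    β≈0 = proj₁ (F.tight (α (suc zero)) F.0#) λ β#0 →
      let γ , γβy≈y = unscale β#0
      in y∉⟨x⟩ (Subspace.≈-closed ⟨ x ⟩ γβy≈y (Subspace.*-closed ⟨ x ⟩ γ
           (Subspace.≈-closed ⟨ x ⟩ -αx≈βy (Subspace.*-closed ⟨ x ⟩ (F.- F.1#) (multiple⇒⟨⟩ (α zero) ≈ᴹ-refl)))))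
      where
      -αx≈βy : (F.- F.1#) *ₗ (α zero *ₗ x) ≈ᴹ α (suc zero) *ₗ y
      -αx≈βy = VP.∙-cancelˡ (α zero *ₗ x) _ _ (≈ᴹ-trans
        (≈ᴹ-trans (+ᴹ-congʳ (≈ᴹ-sym (*ₗ-identityˡ _)))
          (≈ᴹ-trans (≈ᴹ-sym (*ₗ-distribʳ (α zero *ₗ x) F.1# (F.- F.1#)))
            (≈ᴹ-trans (*ₗ-cong (FR.-‿inverseʳ F.1#) ≈ᴹ-refl) (*ₗ-zeroˡ _))))
        (≈ᴹ-sym αx+βy≈0))
    α≈0 : α zero F.≈ F.0#
    α≈0 = scale≈0⇒α≈0 x≉0 (≈ᴹ-trans (≈ᴹ-sym (+ᴹ-identityʳ _))
      (≈ᴹ-trans (+ᴹ-congˡ (≈ᴹ-sym (≈ᴹ-trans (*ₗ-cong β≈0 ≈ᴹ-refl) (*ₗ-zeroˡ y)))) αx+βy≈0))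

  vectors-enum : Finite vectors
  vectors-enum = vectors-finite F-finite V-dim

  X : Fin (proj₁ vectors-enum) → Carrierᴹ
  X = Inverse.to (proj₂ vectors-enum)

  index : ∀ x → ∃ λ i → X i ≈ᴹ x
  index x = Inverse.from (proj₂ vectors-enum) x , Inverse.strictlyInverseˡ (proj₂ vectors-enum) x

  -- Coordinates in the basis identify `P` with the r-tuples of scalars. Stating it for a predicate
  -- covers lines, spans and the whole space alike.
  ∑-dimension : ∀ {p} {P : Pred Carrierᴹ p} (P? : U.Decidable P) → P Respects _≈ᴹ_ →
    ∀ {r} ((b , _) : HasDimension P r) → (∀ α → combination α b ∈ P) →
    ∑ℤ (λ i → 𝟙 (P? (X i))) ≡ + (q ℕ.^ r)
  ∑-dimension P? resp {r} (b , isBasis) closed =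
    ∑-enumerated vectors vectors-enum P? resp
      (λ j → combination (scalars j) b) (λ j → closed (scalars j))
      (λ eq → tuple-injective FR.setoid F-finite {r} (independent⇒injective independent _ _ eq))
      (λ x∈P → let α , x≈ = spanning x∈P
                   j , eq = tuple-surjective FR.setoid F-finite α
               in j , ≈ᴹ-trans x≈ (combination-cong (λ i → F.sym (eq i)) (λ _ → ≈ᴹ-refl)))
    where
    open IsBasis isBasis
    scalars : Fin (q ℕ.^ r) → Vector FR.Carrier r
    scalars = tuple FR.setoid F-finite {r}

  ∑-span : ∀ {r} (b : Vector Carrierᴹ r) → LinearlyIndependent b →
           ∑ℤ (λ i → 𝟙 (∈-span? F-finite V-dim b (X i))) ≡ + (q ℕ.^ r)
  ∑-span b ind = ∑-dimension (∈-span? F-finite V-dim b) (Subspace.≈-closed (span b))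
    (b , span-isBasis ind) (λ α → α , ≈ᴹ-refl)

  ∑-line : ∀ W → ∑ℤ (λ i → 𝟙 (X i ∈ₗ? W)) ≡ + (q ℕ.^ 2)
  ∑-line W@(W′ , dim) = ∑-dimension (_∈ₗ? W) (Subspace.≈-closed W′) dim
    (λ α → combination-closed W′ α (IsBasis.members (proj₂ dim)))

  ∑-all : ∑ℤ {proj₁ vectors-enum} (λ _ → 1ℤ) ≡ + (q ℕ.^ n)
  ∑-all = ∑-dimension {P = U.U} (λ _ → yes tt) (λ _ _ → tt) V-dim (λ _ → tt)

  -- A line has as many vectors as the span of two independent vectors in it.

  line⊆span : ∀ ((W , _) : Line) {x y} → x ≉ᴹ 0ᴹ → y ∉ member ⟨ x ⟩ →
              x ∈ member W → y ∈ member W → member W ⊆ member (span (pair x y))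
  line⊆span W@(W′ , _) {x} {y} x≉0 y∉⟨x⟩ x∈W y∈W {z} z∈W =
    let i , Xi≈z = index z in
    Subspace.≈-closed (span (pair x y)) Xi≈z
      (equinumerous⇒⊇ (λ i → ∈-span? F-finite V-dim (pair x y) (X i)) (λ i → X i ∈ₗ? W)
        (λ (α , eq) → Subspace.≈-closed W′ (≈ᴹ-sym eq)
          (combination-closed W′ α {pair x y} (λ { zero → x∈W ; (suc zero) → y∈W })))
        (≡.trans (∑-span (pair x y) (independent₂ x≉0 y∉⟨x⟩)) (≡.sym (∑-line W)))
        (Subspace.≈-closed W′ (≈ᴹ-sym Xi≈z) z∈W))

  -- Used in both directions, this is the uniqueness of the line through two independent vectors,
  -- and the reason why distinct lines meet in dimension at most 1.
  line⊆line : ∀ (W W′ : Line) {x y} → x ≉ᴹ 0ᴹ → y ∉ member ⟨ x ⟩ →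
              x ∈ member (proj₁ W) → y ∈ member (proj₁ W) →
              x ∈ member (proj₁ W′) → y ∈ member (proj₁ W′) → member (proj₁ W) ⊆ member (proj₁ W′)
  line⊆line W (W′ , _) {x} {y} x≉0 y∉ x∈W y∈W x∈W′ y∈W′ z∈W =
    let α , eq = line⊆span W x≉0 y∉ x∈W y∈W z∈W
    in Subspace.≈-closed W′ (≈ᴹ-sym eq) (combination-closed W′ α {pair x y} (λ { zero → x∈W′ ; (suc zero) → y∈W′ }))

-- Incidences between vectors and lines

module LineCounting {c ℓ₁ ℓ₂ m ℓm} (F : HeytingField c ℓ₁ ℓ₂) (V : VectorSpace F m ℓm)
  {q : ℕ} .{{q≢0 : NonZero q}} (F-order : HasOrder (CommutativeRing.setoid (fieldRing F)) q)
  {n-2 : ℕ} (V-dim : LinearAlgebra.HasDimension F V (U.U {A = Module.Carrierᴹ V}) (ℕ.suc (ℕ.suc n-2))) where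

  open LinearAlgebra F V
  open Module V
  open Grassmann F V F-order V-dim

  Γ = grassmannGraph F V F-finite V-dim
  open FiniteGraph Γ using (order; vertex; _~_; _~?_; enumeration)

  Q M : ℤ
  Q = + q
  M = + (q ℕ.^ n-2)

  power-suc : ∀ k → + (q ℕ.^ ℕ.suc k) ≡ Q ℤ.* + (q ℕ.^ k)
  power-suc k = ℤ.pos-* q (q ℕ.^ k)

  q^1≡Q : + (q ℕ.^ 1) ≡ Q
  q^1≡Q = ≡.cong +_ (ℕ.*-identityʳ q)

  q^2≡QQ : + (q ℕ.^ 2) ≡ Q ℤ.* Q
  q^2≡QQ = ≡.trans (power-suc 1) (≡.cong (λ z → Q ℤ.* z) q^1≡Q)

  infix 9 _∈ₗ_ _∈ₗ⁺_

  _∈ₗ_ _∈ₗ⁺_ : Carrierᴹ → Line → ℤ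
  x ∈ₗ  W = 𝟙 (x ∈ₗ? W)
  x ∈ₗ⁺ W = 𝟙 (x ∈ₗ? W ×-dec ¬? (x ≟0))

  ∑-zero : ∑ℤ (λ i → 𝟙 (X i ≟0)) ≡ 1ℤ
  ∑-zero = let i , Xi≈0 = index 0ᴹ in
    ∑-unique (λ i → X i ≟0) i Xi≈0 (λ Xj≈0 → to-injective vectors vectors-enum (≈ᴹ-trans Xi≈0 (≈ᴹ-sym Xj≈0)))

  ∑-⟨⟩ : ∀ {x} → x ≉ᴹ 0ᴹ → ∑ℤ (λ i → 𝟙 (X i ∈⟨ x ⟩?)) ≡ Q
  ∑-⟨⟩ x≉0 = ≡.trans (∑-span (λ _ → _) (independent₁ x≉0)) q^1≡Q

  ∑-∈ₗ : ∀ W → ∑ℤ (λ i → X i ∈ₗ W) ≡ Q ℤ.* Q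
  ∑-∈ₗ W = ≡.trans (∑-line W) q^2≡QQ

  ∑-∈ₗ⁺ : ∀ W → ∑ℤ (λ i → X i ∈ₗ⁺ W) ≡ Q ℤ.* Q ℤ.- 1ℤ
  ∑-∈ₗ⁺ W@(W′ , _) = ≡.trans
    (∑-difference (λ i → X i ≟0) (λ i → X i ∈ₗ? W)
      (λ Xi≈0 → Subspace.≈-closed W′ (≈ᴹ-sym Xi≈0) (Subspace.0-closed W′)))
    (≡.cong₂ ℤ._-_ (∑-∈ₗ W) ∑-zero)

  ∑-⟨⟩⁺ : ∀ {x} → x ≉ᴹ 0ᴹ → ∑ℤ (λ i → 𝟙 (X i ∈⟨ x ⟩? ×-dec ¬? (X i ≟0))) ≡ Q ℤ.- 1ℤ
  ∑-⟨⟩⁺ {x} x≉0 = ≡.trans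
    (∑-difference (λ i → X i ≟0) (λ i → X i ∈⟨ x ⟩?)
      (λ Xi≈0 → Subspace.≈-closed ⟨ x ⟩ (≈ᴹ-sym Xi≈0) (Subspace.0-closed ⟨ x ⟩)))
    (≡.cong₂ ℤ._-_ (∑-⟨⟩ x≉0) ∑-zero)

  -- A line either contains `⟨ x ⟩` or meets it only in 0, since a nonzero multiple of x generates x
  -- again.
  ∑-line∩⟨⟩ : ∀ {x} → x ≉ᴹ 0ᴹ → ∀ W →
              ∑ℤ (λ i → X i ∈ₗ⁺ W ℤ.* 𝟙 (X i ∈⟨ x ⟩?)) ≡ (Q ℤ.- 1ℤ) ℤ.* x ∈ₗ W
  ∑-line∩⟨⟩ {x} x≉0 W@(W′ , _) with x ∈ₗ? W
  ... | yes x∈W = begin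
    ∑ℤ (λ i → X i ∈ₗ⁺ W ℤ.* 𝟙 (X i ∈⟨ x ⟩?))
      ≡⟨ ℤSum.sum-cong-≗ (λ i → ≡.trans (𝟙-× (X i ∈ₗ? W ×-dec ¬? (X i ≟0)) (X i ∈⟨ x ⟩?))
           (𝟙-⇔ ((X i ∈ₗ? W ×-dec ¬? (X i ≟0)) ×-dec X i ∈⟨ x ⟩?) (X i ∈⟨ x ⟩? ×-dec ¬? (X i ≟0))
             (λ ((_ , y≉0) , y∈⟨x⟩) → y∈⟨x⟩ , y≉0)
             (λ (y∈⟨x⟩ , y≉0) → (⟨⟩⊆ W′ x∈W y∈⟨x⟩ , y≉0) , y∈⟨x⟩))) ⟩
    ∑ℤ (λ i → 𝟙 (X i ∈⟨ x ⟩? ×-dec ¬? (X i ≟0)))  ≡⟨ ∑-⟨⟩⁺ x≉0 ⟩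
    Q ℤ.- 1ℤ                                      ≡⟨ ℤ.*-identityʳ (Q ℤ.- 1ℤ) ⟨
    (Q ℤ.- 1ℤ) ℤ.* 1ℤ                             ∎
  ... | no x∉W = begin
    ∑ℤ (λ i → X i ∈ₗ⁺ W ℤ.* 𝟙 (X i ∈⟨ x ⟩?))
      ≡⟨ ℤSum.sum-cong-≗ (λ i → 𝟙-× (X i ∈ₗ? W ×-dec ¬? (X i ≟0)) (X i ∈⟨ x ⟩?)) ⟩
    ∑ℤ (λ i → 𝟙 ((X i ∈ₗ? W ×-dec ¬? (X i ≟0)) ×-dec X i ∈⟨ x ⟩?))
      ≡⟨ ∑-none (λ i → (X i ∈ₗ? W ×-dec ¬? (X i ≟0)) ×-dec X i ∈⟨ x ⟩?)
           (λ i ((y∈W , y≉0) , y∈⟨x⟩) → x∉W (⟨⟩⊆ W′ y∈W (⟨⟩-sym y≉0 y∈⟨x⟩))) ⟩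
    0ℤ                                            ≡⟨ ℤ.*-zeroʳ (Q ℤ.- 1ℤ) ⟨
    (Q ℤ.- 1ℤ) ℤ.* 0ℤ                             ∎
    where
    ⟨⟩-sym : ∀ {y} → y ≉ᴹ 0ᴹ → y ∈ member ⟨ x ⟩ → x ∈ member ⟨ y ⟩
    ⟨⟩-sym {y} y≉0 y∈⟨x⟩ = decidable-stable (x ∈⟨ y ⟩?) λ x∉⟨y⟩ →
      let α , y≈αx = ⟨⟩⇒multiple y∈⟨x⟩
          α≈0 = proj₁ (HeytingField.tight F α _) λ α#0 →
            let β , βαx≈x = unscale α#0
            in x∉⟨y⟩ (multiple⇒⟨⟩ β (≈ᴹ-trans (≈ᴹ-sym βαx≈x) (*ₗ-cong (HeytingField.refl F) (≈ᴹ-sym y≈αx))))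
      in y≉0 (≈ᴹ-trans y≈αx (≈ᴹ-trans (*ₗ-cong α≈0 ≈ᴹ-refl) (*ₗ-zeroˡ x)))

  degreeOf : Carrierᴹ → ℤ
  degreeOf x = ∑ℤ (λ j → x ∈ₗ vertex j)

  -- The span of x and y is such a line, and `line⊆line` both ways makes it the only one.
  ∑-through-two : ∀ {x y} → x ≉ᴹ 0ᴹ → y ∉ member ⟨ x ⟩ →
                  ∑ℤ (λ j → x ∈ₗ vertex j ℤ.* y ∈ₗ vertex j) ≡ 1ℤ
  ∑-through-two {x} {y} x≉0 y∉⟨x⟩ = ≡.trans
    (ℤSum.sum-cong-≗ (λ j → 𝟙-× (x ∈ₗ? vertex j) (y ∈ₗ? vertex j)))
    (∑-unique (λ j → x ∈ₗ? vertex j ×-dec y ∈ₗ? vertex j) j₀ (x∈j₀ , y∈j₀)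
      (λ {j} (x∈j , y∈j) → to-injective (Grassmannian 2) (_ , enumeration)
        ( line⊆line (vertex j₀) (vertex j) x≉0 y∉⟨x⟩ x∈j₀ y∈j₀ x∈j y∈j
        , line⊆line (vertex j) (vertex j₀) x≉0 y∉⟨x⟩ x∈j y∈j x∈j₀ y∈j₀)))
    where
    W : Line
    W = span (pair x y) , pair x y , span-isBasis (independent₂ x≉0 y∉⟨x⟩)
    j₀ = Inverse.from enumeration W
    W⊆j₀ : member (proj₁ W) ⊆ member (proj₁ (vertex j₀))
    W⊆j₀ = proj₂ (Inverse.strictlyInverseˡ enumeration W)
    x∈j₀ = W⊆j₀ (IsBasis.members (proj₂ (proj₂ W)) zero)
    y∈j₀ = W⊆j₀ (IsBasis.members (proj₂ (proj₂ W)) (suc zero))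

  ∑-through-dependent : ∀ {x y} → y ∈ member ⟨ x ⟩ →
                        ∑ℤ (λ j → x ∈ₗ vertex j ℤ.* y ∈ₗ vertex j) ≡ degreeOf x
  ∑-through-dependent {x} {y} y∈⟨x⟩ = ℤSum.sum-cong-≗ (λ j → begin
    x ∈ₗ vertex j ℤ.* y ∈ₗ vertex j    ≡⟨ 𝟙-*-congˡ (x ∈ₗ? vertex j)
        (λ x∈j → 𝟙-yes (y ∈ₗ? vertex j) (⟨⟩⊆ (proj₁ (vertex j)) x∈j y∈⟨x⟩)) ⟩
    x ∈ₗ vertex j ℤ.* 1ℤ               ≡⟨ ℤ.*-identityʳ _ ⟩
    x ∈ₗ vertex j                      ∎)

  -- Both cases for y are merged into an affine function of one indicator, the form that `∑-affine`
  -- can sum; y = 0 falls under the dependent case.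
  ∑-through : ∀ {x} → x ≉ᴹ 0ᴹ → ∀ y → ∑ℤ (λ j → x ∈ₗ vertex j ℤ.* y ∈ₗ vertex j)
                                    ≡ 1ℤ ℤ.+ (degreeOf x ℤ.- 1ℤ) ℤ.* 𝟙 (y ∈⟨ x ⟩?)
  ∑-through {x} x≉0 y with y ∈⟨ x ⟩?
  ... | yes y∈⟨x⟩ = ≡.trans (∑-through-dependent y∈⟨x⟩) (one (degreeOf x))
    where
    one : ∀ d → d ≡ 1ℤ ℤ.+ (d ℤ.- 1ℤ) ℤ.* 1ℤ
    one = solve-∀
  ... | no  y∉⟨x⟩ = ≡.trans (∑-through-two x≉0 y∉⟨x⟩)
    (≡.cong (λ z → 1ℤ ℤ.+ z) (≡.sym (ℤ.*-zeroʳ (degreeOf x ℤ.- 1ℤ))))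

  -- Double counting of the pairs (y , W) with x ∈ W ∋ y and y ∉ ⟨ x ⟩.

  degreeOf-nonzero : ∀ {x} → x ≉ᴹ 0ᴹ → (Q ℤ.- 1ℤ) ℤ.* degreeOf x ≡ Q ℤ.* M ℤ.- 1ℤ
  -- The count reads d (q² - q) = q^n - q for d = `degreeOf x`; the common factor q is cancelled.
  degreeOf-nonzero {x} x≉0 = ℤ.*-cancelˡ-≡ Q _ _ {{q≢0}} (begin
    Q ℤ.* ((Q ℤ.- 1ℤ) ℤ.* degreeOf x)                     ≡⟨ regroup Q (degreeOf x) ⟩
    degreeOf x ℤ.* (Q ℤ.* Q ℤ.- Q)                        ≡⟨ ℤSum.*-distribʳ-sum (Q ℤ.* Q ℤ.- Q) (λ j → x ∈ₗ vertex j) ⟩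
    ∑ℤ (λ j → x ∈ₗ vertex j ℤ.* (Q ℤ.* Q ℤ.- Q))
      ≡⟨ ℤSum.sum-cong-≗ (λ j → 𝟙-*-congˡ (x ∈ₗ? vertex j) (outside (vertex j))) ⟨
    ∑ℤ (λ j → x ∈ₗ vertex j ℤ.* ∑ℤ (λ i → 𝟙 (¬? (X i ∈⟨ x ⟩?)) ℤ.* X i ∈ₗ vertex j))
      ≡⟨ ∑-∑-linear (λ i → 𝟙 (¬? (X i ∈⟨ x ⟩?))) (λ j → x ∈ₗ vertex j) (λ i j → X i ∈ₗ vertex j) ⟩
    ∑ℤ (λ i → 𝟙 (¬? (X i ∈⟨ x ⟩?)) ℤ.* ∑ℤ (λ j → x ∈ₗ vertex j ℤ.* X i ∈ₗ vertex j))
      ≡⟨ ℤSum.sum-cong-≗ (λ i → ≡.trans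
           (𝟙-*-congˡ (¬? (X i ∈⟨ x ⟩?)) (∑-through-two x≉0))
           (≡.trans (ℤ.*-identityʳ _) (𝟙-¬ (X i ∈⟨ x ⟩?)))) ⟩
    ∑ℤ ((λ _ → 1ℤ) ⊖ (λ i → 𝟙 (X i ∈⟨ x ⟩?)))             ≡⟨ ∑-⊖ (λ _ → 1ℤ) (λ i → 𝟙 (X i ∈⟨ x ⟩?)) ⟩
    ∑ℤ {proj₁ vectors-enum} (λ _ → 1ℤ) ℤ.- ∑ℤ (λ i → 𝟙 (X i ∈⟨ x ⟩?))
      ≡⟨ ≡.cong₂ ℤ._-_ (≡.trans ∑-all (≡.trans (power-suc (ℕ.suc n-2)) (≡.cong (λ z → Q ℤ.* z) (power-suc n-2)))) (∑-⟨⟩ x≉0) ⟩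
    Q ℤ.* (Q ℤ.* M) ℤ.- Q                                 ≡⟨ factor Q (Q ℤ.* M) ⟩
    Q ℤ.* (Q ℤ.* M ℤ.- 1ℤ)                                ∎)
    where
    regroup : ∀ Q d → Q ℤ.* ((Q ℤ.- 1ℤ) ℤ.* d) ≡ d ℤ.* (Q ℤ.* Q ℤ.- Q)
    regroup = solve-∀
    factor : ∀ Q z → Q ℤ.* z ℤ.- Q ≡ Q ℤ.* (z ℤ.- 1ℤ)
    factor = solve-∀
    outside : ∀ W → x ∈ member (proj₁ W) →
              ∑ℤ (λ i → 𝟙 (¬? (X i ∈⟨ x ⟩?)) ℤ.* X i ∈ₗ W) ≡ Q ℤ.* Q ℤ.- Q
    outside W x∈W = begin
      ∑ℤ (λ i → 𝟙 (¬? (X i ∈⟨ x ⟩?)) ℤ.* X i ∈ₗ W)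
        ≡⟨ ℤSum.sum-cong-≗ (λ i → ≡.trans (ℤ.*-comm (𝟙 (¬? (X i ∈⟨ x ⟩?))) (X i ∈ₗ W))
             (𝟙-× (X i ∈ₗ? W) (¬? (X i ∈⟨ x ⟩?)))) ⟩
      ∑ℤ (λ i → 𝟙 (X i ∈ₗ? W ×-dec ¬? (X i ∈⟨ x ⟩?)))
        ≡⟨ ∑-difference (λ i → X i ∈⟨ x ⟩?) (λ i → X i ∈ₗ? W) (⟨⟩⊆ (proj₁ W) x∈W) ⟩
      ∑ℤ (λ i → X i ∈ₗ W) ℤ.- ∑ℤ (λ i → 𝟙 (X i ∈⟨ x ⟩?))
        ≡⟨ ≡.cong₂ ℤ._-_ (∑-∈ₗ W) (∑-⟨⟩ x≉0) ⟩
      Q ℤ.* Q ℤ.- Q ∎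

  -- Intersection numbers of lines

  meet : Line → Line → ℤ
  meet W W′ = ∑ℤ (λ i → X i ∈ₗ⁺ W ℤ.* X i ∈ₗ W′)

  -- For each nonzero y in W, the lines through x and y are counted: one in general, all d =
  -- `degreeOf x` of them if y is a multiple of x. The surplus (d - 1)(q - 1), present when x lies
  -- in W, equals q^(n-1) - q; this is the origin of g.
  ∑-meet-through : ∀ {x} → x ≉ᴹ 0ᴹ → ∀ W → ∑ℤ (λ j → x ∈ₗ vertex j ℤ.* meet W (vertex j))
                   ≡ (Q ℤ.* Q ℤ.- 1ℤ) ℤ.+ (Q ℤ.* M ℤ.- Q) ℤ.* x ∈ₗ W
  ∑-meet-through {x} x≉0 W = begin
    ∑ℤ (λ j → x ∈ₗ vertex j ℤ.* meet W (vertex j))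
      ≡⟨ ∑-∑-linear (λ i → X i ∈ₗ⁺ W) (λ j → x ∈ₗ vertex j) (λ i j → X i ∈ₗ vertex j) ⟩
    ∑ℤ (λ i → X i ∈ₗ⁺ W ℤ.* ∑ℤ (λ j → x ∈ₗ vertex j ℤ.* X i ∈ₗ vertex j))
      ≡⟨ ℤSum.sum-cong-≗ (λ i → ≡.cong (λ z → X i ∈ₗ⁺ W ℤ.* z) (∑-through x≉0 (X i))) ⟩
    ∑ℤ (λ i → X i ∈ₗ⁺ W ℤ.* (1ℤ ℤ.+ (degreeOf x ℤ.- 1ℤ) ℤ.* 𝟙 (X i ∈⟨ x ⟩?)))
      ≡⟨ ∑-affine (λ i → X i ∈ₗ⁺ W) (λ i → 𝟙 (X i ∈⟨ x ⟩?)) 1ℤ (degreeOf x ℤ.- 1ℤ) ⟩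
    ∑ℤ (λ i → X i ∈ₗ⁺ W) ℤ.* 1ℤ ℤ.+ (degreeOf x ℤ.- 1ℤ) ℤ.* ∑ℤ (λ i → X i ∈ₗ⁺ W ℤ.* 𝟙 (X i ∈⟨ x ⟩?))
      ≡⟨ ≡.cong₂ (λ a b → a ℤ.* 1ℤ ℤ.+ (degreeOf x ℤ.- 1ℤ) ℤ.* b) (∑-∈ₗ⁺ W) (∑-line∩⟨⟩ x≉0 W) ⟩
    (Q ℤ.* Q ℤ.- 1ℤ) ℤ.* 1ℤ ℤ.+ (degreeOf x ℤ.- 1ℤ) ℤ.* ((Q ℤ.- 1ℤ) ℤ.* x ∈ₗ W)
      ≡⟨ regroup Q (degreeOf x) (x ∈ₗ W) ⟩
    (Q ℤ.* Q ℤ.- 1ℤ) ℤ.+ ((Q ℤ.- 1ℤ) ℤ.* degreeOf x ℤ.- Q ℤ.+ 1ℤ) ℤ.* x ∈ₗ W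
      ≡⟨ ≡.cong (λ z → (Q ℤ.* Q ℤ.- 1ℤ) ℤ.+ (z ℤ.- Q ℤ.+ 1ℤ) ℤ.* x ∈ₗ W) (degreeOf-nonzero x≉0) ⟩
    (Q ℤ.* Q ℤ.- 1ℤ) ℤ.+ (Q ℤ.* M ℤ.- 1ℤ ℤ.- Q ℤ.+ 1ℤ) ℤ.* x ∈ₗ W
      ≡⟨ ≡.cong (λ z → (Q ℤ.* Q ℤ.- 1ℤ) ℤ.+ z ℤ.* x ∈ₗ W) (cancel (Q ℤ.* M) Q) ⟩
    (Q ℤ.* Q ℤ.- 1ℤ) ℤ.+ (Q ℤ.* M ℤ.- Q) ℤ.* x ∈ₗ W ∎
    where
    regroup : ∀ Q d w → (Q ℤ.* Q ℤ.- 1ℤ) ℤ.* 1ℤ ℤ.+ (d ℤ.- 1ℤ) ℤ.* ((Q ℤ.- 1ℤ) ℤ.* w)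
                      ≡ (Q ℤ.* Q ℤ.- 1ℤ) ℤ.+ ((Q ℤ.- 1ℤ) ℤ.* d ℤ.- Q ℤ.+ 1ℤ) ℤ.* w
    regroup = solve-∀
    cancel : ∀ z Q → z ℤ.- 1ℤ ℤ.- Q ℤ.+ 1ℤ ≡ z ℤ.- Q
    cancel = solve-∀

  ∈ₗ⁺-*-congˡ : ∀ x W {a b} → (x ≉ᴹ 0ᴹ → a ≡ b) → x ∈ₗ⁺ W ℤ.* a ≡ x ∈ₗ⁺ W ℤ.* b
  ∈ₗ⁺-*-congˡ x W a≡b = 𝟙-*-congˡ (x ∈ₗ? W ×-dec ¬? (x ≟0)) (λ (_ , x≉0) → a≡b x≉0)

  -- One factor is expanded over the nonzero vectors x of W. The inner sums are then those of
  -- `∑-meet-through` for W′, which requires x to be nonzero.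
  meet² : ∀ W W′ → ∑ℤ (λ j → meet W (vertex j) ℤ.* meet W′ (vertex j))
        ≡ (Q ℤ.* Q ℤ.- 1ℤ) ℤ.* (Q ℤ.* Q ℤ.- 1ℤ) ℤ.+ (Q ℤ.* M ℤ.- Q) ℤ.* meet W W′
  meet² W W′ = begin
    ∑ℤ (λ j → meet W (vertex j) ℤ.* meet W′ (vertex j))
      ≡⟨ ℤSum.sum-cong-≗ (λ j → ℤ.*-comm (meet W (vertex j)) (meet W′ (vertex j))) ⟩
    ∑ℤ (λ j → meet W′ (vertex j) ℤ.* meet W (vertex j))
      ≡⟨ ∑-∑-linear (λ i → X i ∈ₗ⁺ W) (λ j → meet W′ (vertex j)) (λ i j → X i ∈ₗ vertex j) ⟩
    ∑ℤ (λ i → X i ∈ₗ⁺ W ℤ.* ∑ℤ (λ j → meet W′ (vertex j) ℤ.* X i ∈ₗ vertex j))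
      ≡⟨ ℤSum.sum-cong-≗ (λ i → ∈ₗ⁺-*-congˡ (X i) W (λ x≉0 → ≡.trans
           (ℤSum.sum-cong-≗ (λ j → ℤ.*-comm (meet W′ (vertex j)) (X i ∈ₗ vertex j)))
           (∑-meet-through x≉0 W′))) ⟩
    ∑ℤ (λ i → X i ∈ₗ⁺ W ℤ.* ((Q ℤ.* Q ℤ.- 1ℤ) ℤ.+ (Q ℤ.* M ℤ.- Q) ℤ.* X i ∈ₗ W′))
      ≡⟨ ∑-affine (λ i → X i ∈ₗ⁺ W) (λ i → X i ∈ₗ W′) (Q ℤ.* Q ℤ.- 1ℤ) (Q ℤ.* M ℤ.- Q) ⟩
    ∑ℤ (λ i → X i ∈ₗ⁺ W) ℤ.* (Q ℤ.* Q ℤ.- 1ℤ) ℤ.+ (Q ℤ.* M ℤ.- Q) ℤ.* meet W W′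
      ≡⟨ ≡.cong (λ z → z ℤ.* (Q ℤ.* Q ℤ.- 1ℤ) ℤ.+ (Q ℤ.* M ℤ.- Q) ℤ.* meet W W′) (∑-∈ₗ⁺ W) ⟩
    (Q ℤ.* Q ℤ.- 1ℤ) ℤ.* (Q ℤ.* Q ℤ.- 1ℤ) ℤ.+ (Q ℤ.* M ℤ.- Q) ℤ.* meet W W′ ∎

  -- The factor q - 1 enters as a constant weight on the lines, so that the inner sum becomes the
  -- known multiple of the number of lines through a vector.
  meet-sum : ∀ W → (Q ℤ.- 1ℤ) ℤ.* ∑ℤ (λ j → meet W (vertex j)) ≡ (Q ℤ.* Q ℤ.- 1ℤ) ℤ.* (Q ℤ.* M ℤ.- 1ℤ)
  meet-sum W = begin
    (Q ℤ.- 1ℤ) ℤ.* ∑ℤ (λ j → meet W (vertex j))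
      ≡⟨ ℤSum.*-distribˡ-sum (Q ℤ.- 1ℤ) (λ j → meet W (vertex j)) ⟩
    ∑ℤ (λ j → (Q ℤ.- 1ℤ) ℤ.* meet W (vertex j))
      ≡⟨ ∑-∑-linear (λ i → X i ∈ₗ⁺ W) (λ j → Q ℤ.- 1ℤ) (λ i j → X i ∈ₗ vertex j) ⟩
    ∑ℤ (λ i → X i ∈ₗ⁺ W ℤ.* ∑ℤ (λ j → (Q ℤ.- 1ℤ) ℤ.* X i ∈ₗ vertex j))
      ≡⟨ ℤSum.sum-cong-≗ (λ i → ∈ₗ⁺-*-congˡ (X i) W (λ x≉0 → ≡.trans
           (≡.sym (ℤSum.*-distribˡ-sum (Q ℤ.- 1ℤ) (λ j → X i ∈ₗ vertex j)))
           (degreeOf-nonzero x≉0))) ⟩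
    ∑ℤ (λ i → X i ∈ₗ⁺ W ℤ.* (Q ℤ.* M ℤ.- 1ℤ))
      ≡⟨ ℤSum.*-distribʳ-sum (Q ℤ.* M ℤ.- 1ℤ) (λ i → X i ∈ₗ⁺ W) ⟨
    ∑ℤ (λ i → X i ∈ₗ⁺ W) ℤ.* (Q ℤ.* M ℤ.- 1ℤ)
      ≡⟨ ≡.cong (ℤ._* (Q ℤ.* M ℤ.- 1ℤ)) (∑-∈ₗ⁺ W) ⟩
    (Q ℤ.* Q ℤ.- 1ℤ) ℤ.* (Q ℤ.* M ℤ.- 1ℤ) ∎

  meet-self : ∀ W → meet W W ≡ Q ℤ.* Q ℤ.- 1ℤ
  meet-self W = ≡.trans
    (ℤSum.sum-cong-≗ (λ i → ≡.trans
      (𝟙-*-congˡ (X i ∈ₗ? W ×-dec ¬? (X i ≟0)) (λ (x∈W , _) → 𝟙-yes (X i ∈ₗ? W) x∈W))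
      (ℤ.*-identityʳ _)))
    (∑-∈ₗ⁺ W)

  -- A common vector outside `⟨ z ⟩` would, together with z, force the two lines to coincide.
  meet-adjacent : ∀ {W W′} → W ~ W′ → meet W W′ ≡ Q ℤ.- 1ℤ
  meet-adjacent {W} {W′} (W≉W′ , z , z≉0 , z∈W , z∈W′) = begin
    ∑ℤ (λ i → X i ∈ₗ⁺ W ℤ.* X i ∈ₗ W′)
      ≡⟨ ℤSum.sum-cong-≗ (λ i → ≡.trans (𝟙-× (X i ∈ₗ? W ×-dec ¬? (X i ≟0)) (X i ∈ₗ? W′))
           (𝟙-⇔ ((X i ∈ₗ? W ×-dec ¬? (X i ≟0)) ×-dec X i ∈ₗ? W′) (X i ∈⟨ z ⟩? ×-dec ¬? (X i ≟0))
             (λ ((x∈W , x≉0) , x∈W′) → meet⊆⟨z⟩ x∈W x∈W′ , x≉0)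
             (λ (x∈⟨z⟩ , x≉0) → (⟨⟩⊆ (proj₁ W) z∈W x∈⟨z⟩ , x≉0) , ⟨⟩⊆ (proj₁ W′) z∈W′ x∈⟨z⟩))) ⟩
    ∑ℤ (λ i → 𝟙 (X i ∈⟨ z ⟩? ×-dec ¬? (X i ≟0)))   ≡⟨ ∑-⟨⟩⁺ z≉0 ⟩
    Q ℤ.- 1ℤ                                       ∎
    where
    meet⊆⟨z⟩ : ∀ {x} → x ∈ member (proj₁ W) → x ∈ member (proj₁ W′) → x ∈ member ⟨ z ⟩
    meet⊆⟨z⟩ {x} x∈W x∈W′ = decidable-stable (x ∈⟨ z ⟩?) λ x∉⟨z⟩ →
      W≉W′ ( line⊆line W W′ z≉0 x∉⟨z⟩ z∈W x∈W z∈W′ x∈W′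
           , line⊆line W′ W z≉0 x∉⟨z⟩ z∈W′ x∈W′ z∈W x∈W)

  meet-disjoint : ∀ {W W′} → ¬ (member (proj₁ W) U.≐ member (proj₁ W′)) → ¬ (W ~ W′) → meet W W′ ≡ 0ℤ
  meet-disjoint {W} {W′} W≉W′ W≁W′ = ≡.trans
    (ℤSum.sum-cong-≗ (λ i → 𝟙-× (X i ∈ₗ? W ×-dec ¬? (X i ≟0)) (X i ∈ₗ? W′)))
    (∑-none (λ i → (X i ∈ₗ? W ×-dec ¬? (X i ≟0)) ×-dec X i ∈ₗ? W′)
      (λ i ((x∈W , x≉0) , x∈W′) → W≁W′ (W≉W′ , X i , x≉0 , x∈W , x∈W′)))

  meet-matrix : ∀ i j → meet (vertex i) (vertex j)
              ≡ (Q ℤ.* Q ℤ.- 1ℤ) ℤ.* identity i j ℤ.+ (Q ℤ.- 1ℤ) ℤ.* adjacencyMatrix Γ i j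
  -- Passing the two decisions as arguments lets the entries of `identity` and of the adjacency
  -- matrix reduce in each case.
  meet-matrix i j = by-cases (i ≟ j) (vertex i ~? vertex j)
    where
    only-identity : ∀ a b → a ≡ a ℤ.* 1ℤ ℤ.+ b ℤ.* 0ℤ
    only-identity = solve-∀
    only-adjacency : ∀ a b → b ≡ a ℤ.* 0ℤ ℤ.+ b ℤ.* 1ℤ
    only-adjacency = solve-∀
    neither : ∀ a b → 0ℤ ≡ a ℤ.* 0ℤ ℤ.+ b ℤ.* 0ℤ
    neither = solve-∀
    by-cases : (i≟j : Dec (i ≡ j)) (i~?j : Dec (vertex i ~ vertex j)) →
      meet (vertex i) (vertex j) ≡ (Q ℤ.* Q ℤ.- 1ℤ) ℤ.* 𝟙 i≟j ℤ.+ (Q ℤ.- 1ℤ) ℤ.* 𝟙 i~?j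
    by-cases (yes ≡.refl) (yes i~i) = contradiction i~i
      (FiniteGraph.~-irrefl Γ {vertex i} {vertex i} (Setoid.refl (FiniteGraph.vertices Γ) {vertex i}))
    by-cases (yes ≡.refl) (no _)    = ≡.trans (meet-self (vertex i))
      (only-identity (Q ℤ.* Q ℤ.- 1ℤ) (Q ℤ.- 1ℤ))
    by-cases (no _)       (yes i~j) = ≡.trans (meet-adjacent {vertex i} {vertex j} i~j)
      (only-adjacency (Q ℤ.* Q ℤ.- 1ℤ) (Q ℤ.- 1ℤ))
    by-cases (no i≢j)     (no i≁j)  = ≡.trans
      (meet-disjoint {vertex i} {vertex j} (λ i≈j → i≢j (to-injective (Grassmannian 2) (_ , enumeration) i≈j)) i≁j)
      (neither (Q ℤ.* Q ℤ.- 1ℤ) (Q ℤ.- 1ℤ))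

  -- The Laplacian of the Grassmann graph

  A : Matrix order
  A = adjacencyMatrix Γ

  A-sym : ∀ i j → A i j ≡ A j i
  A-sym i j = 𝟙-⇔ (vertex i ~? vertex j) (vertex j ~? vertex i)
    (FiniteGraph.~-sym Γ {vertex i} {vertex j}) (FiniteGraph.~-sym Γ {vertex j} {vertex i})

  A-sum : ∀ {k} → FiniteGraph.HasValency Γ k → ∀ i → ∑ℤ (A i) ≡ + k
  A-sum valency i = ≡.trans (∑-filter (λ j → vertex i ~? vertex j) (λ j → j)) (≡.cong +_ (valency i))

  grassmannLaplacian-no-p-torsion : ∀ {p} → Prime p → p ℕ∣.∣ q → ∀ {k} → FiniteGraph.HasValency Γ k →
    (∀ e → ElementaryDivisor (laplacian Γ k) p e → e ≡ 0) ×
    (∃ λ s → HasOrder (AbelianGroup.setoid (criticalGroup (laplacian Γ k))) s × ¬ (p ℕ∣.∣ s))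
  grassmannLaplacian-no-p-torsion pr p∣q {k} valency =
    regularLaplacian-no-p-torsion A k Q M pr (ℤ∣.∣ᵤ⇒∣ p∣q) A-sym (A-sum valency)
      (λ i l → begin
        ∑ℤ (λ j → C i j ℤ.* C l j)
          ≡⟨ ℤSum.sum-cong-≗ (λ j → ≡.cong₂ ℤ._*_ (meet-matrix i j) (meet-matrix l j)) ⟨
        ∑ℤ (λ j → meet (vertex i) (vertex j) ℤ.* meet (vertex l) (vertex j))
          ≡⟨ meet² (vertex i) (vertex l) ⟩
        s ℤ.* s ℤ.+ g ℤ.* meet (vertex i) (vertex l)
          ≡⟨ ≡.cong (λ z → s ℤ.* s ℤ.+ g ℤ.* z) (meet-matrix i l) ⟩
        s ℤ.* s ℤ.+ g ℤ.* C i l ∎)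
      (λ i → ≡.trans (≡.cong (λ z → r ℤ.* z) (≡.sym (ℤSum.sum-cong-≗ (meet-matrix i))))
                     (meet-sum (vertex i)))
    where open RegularLaplacian A k Q M A-sym (A-sum valency) using (C; s; r; g)

mainTheorem4 : {c ℓ₁ ℓ₂ m ℓm : Level} (p t n : ℕ) → Prime p → 1 ≤ t → 4 ≤ n →
    (F : HeytingField c ℓ₁ ℓ₂)
    (F-order : HasOrder (CommutativeRing.setoid (fieldRing F)) (p ^ t))
    (V : VectorSpace F m ℓm)
    (V-dim : LinearAlgebra.HasDimension F V (U {A = Module.Carrierᴹ V}) n) →
    let Γ = grassmannGraph F V (p ^ t , F-order) V-dim in
    (k : ℕ) → FiniteGraph.HasValency Γ k →
    let L = laplacian Γ k in
    (∀ e → ElementaryDivisor L p e → e ≡ 0) ×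
    (∃ λ s → HasOrder (AbelianGroup.setoid (criticalGroup L)) s × ¬ (p ∣ s))
mainTheorem4 p (ℕ.suc t) _ pr _ (ℕ.s≤s (ℕ.s≤s _)) F F-order V V-dim k valency =
  -- A positive exponent gives `p ∣ q`, and the two successors exposed in n leave n - 2 as the
  -- exponent in `M`.
  LineCounting.grassmannLaplacian-no-p-torsion F V F-order V-dim pr (ℕ∣.m∣m*n (p ^ t)) valency
  where instance _ = ℕ.m^n≢0 p (ℕ.suc t) {{prime⇒nonZero pr}}
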